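{- There is an algorithm that solves \textsc{Path Contraction With Constrained Ends} in time $\mathcal{O}^*(2^{k-|X|-|Y|})$, where $(G,X,Y,k)$ is the input instance.
   Context: All graphs are finite, simple and undirected; $n=|V(G)|$. Contracting an edge $uv$ replaces $u,v$ by a new vertex adjacent to $N(u)\cup N(v)\setminus\{u,v\}$ (no loops or parallel edges). A graph $G$ is contractible to a path $P_\ell$ with witness structure $(W_1,\ldots,W_\ell)$ if $W_1,\ldots,W_\ell$ is a partition of $V(G)$ into non-empty sets each inducing a connected subgraph, and $W_i,W_j$ are adjacent (some edge joins them) if and only if $|i-j|=1$. $G$ is $k$-contractible to the path via this witness structure if $\sum_{i}(|W_i|-1)\le k$ (equivalently, the path is obtained by at most $k$ edge contractions). \textsc{Path Contraction With Constrained Ends}: given a connected graph $G$, two disjoint subsets $X,Y\subseteq V(G)$ and an integer $k$, decide whether one can contract at most $k$ edges of $G$ to obtain a path with witness structure $(W_1,\ldots,W_\ell)$ such that $X\subseteq W_1$ and $Y\subseteq W_\ell$. The notation $\mathcal{O}^*(\cdot)$ suppresses factors polynomial in the input size. -}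

module Defs where

open import Data.Bool.Base using (Bool; true; false)
open import Data.Fin.Base using (Fin; zero; suc; toℕ; fromℕ)
open import Data.Fin.Subset using (Subset; _∈_; _⊆_; _∩_; ⊤; ∣_∣; Nonempty; Empty)
open import Data.Nat.Base using (ℕ; zero; suc; _+_; _∸_; _≤_; ∣_-_∣)
open import Data.Nat.Binary.Base as ℕᵇ using (ℕᵇ; 2[1+_]; 1+[2_])
open import Data.Product.Base using (_×_; _,_; ∃; ∃₂; ∃-syntax)
open import Data.Vec.Base using (Vec; []; _∷_; lookup; map; sum; tabulate)
open import Function.Bundles using (_⇔_)
open import Relation.Binary.Construct.Closure.ReflexiveTransitive using (Star)
open import Relation.Binary.PropositionalEquality using (_≡_; _≢_; refl)
open import Relation.Nullary.Negation.Core using (¬_)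

------------------------------------------------------------------------
-- Graphs

record Graph (n : ℕ) : Set where
  field
    adj       : Fin n → Fin n → Bool
    symmetric : ∀ u v → adj u v ≡ adj v u
    loopless  : ∀ v → adj v v ≡ false

  Edge : Fin n → Fin n → Set
  Edge u v = adj u v ≡ true

  EdgeWithin : Subset n → Fin n → Fin n → Set
  EdgeWithin S u v = u ∈ S × v ∈ S × Edge u v

  -- The null graph does not count as connected.
  InducesConnected : Subset n → Set
  InducesConnected S =
    Nonempty S × (∀ {u v} → u ∈ S → v ∈ S → Star (EdgeWithin S) u v)

  Connected : Set
  Connected = InducesConnected ⊤

  Adjacent : Subset n → Subset n → Set
  Adjacent S T = ∃₂ λ u v → u ∈ S × v ∈ T × Edge u v

------------------------------------------------------------------------
-- Contraction to a path

-- The path P_ℓ has ℓ = suc m ≥ 1 vertices, so that the first bag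
-- `lookup W zero` and the last bag `lookup W (fromℕ m)` exist; they
-- coincide when ℓ = 1.

record IsPathWitness {n m : ℕ} (G : Graph n) (W : Vec (Subset n) (suc m)) : Set where
  open Graph G
  field
    covering  : ∀ v → ∃[ i ] v ∈ lookup W i
    disjoint  : ∀ {v i j} → v ∈ lookup W i → v ∈ lookup W j → i ≡ j
    nonempty  : ∀ i → Nonempty (lookup W i)
    connected : ∀ i → InducesConnected (lookup W i)
    path      : ∀ i j → i ≢ j →
                Adjacent (lookup W i) (lookup W j) ⇔ ∣ toℕ i - toℕ j ∣ ≡ 1

contractions : ∀ {n ℓ} → Vec (Subset n) ℓ → ℕ
contractions W = sum (map (λ S → ∣ S ∣ ∸ 1) W)

record Instance : Set where
  field
    {n}       : ℕ
    G         : Graph n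
    connected : Graph.Connected G
    X Y       : Subset n
    disjoint  : Empty (X ∩ Y)
    k         : ℕ

PathContractionWithConstrainedEnds : Instance → Set
PathContractionWithConstrainedEnds I =
  ∃[ m ] ∃[ W ]
    IsPathWitness {n} {m} G W
    × contractions W ≤ k
    × X ⊆ lookup W zero
    × Y ⊆ lookup W (fromℕ m)
  where open Instance I

------------------------------------------------------------------------
-- Model of computation

-- Algorithms are first-order, call-by-value functional programs over
-- binary trees, with one unit of time per evaluation rule applied.  There
-- are no other primitives.  Since trees may be stored as shared pointers
-- and environments have length bounded in terms of the program alone, each
-- rule amounts to boundedly many pointer operations.  Hence T units of time
-- here are O(T) steps on a pointer machine, and the classes O*(f) are those
-- of a random access machine with logarithmic-size words.

data Tree : Set where
  leaf : Tree
  node : Tree → Tree → Tree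

-- `Exp p e`: expressions with e free variables (de Bruijn indices) that may
-- call p global, mutually recursive, unary functions.

data Exp (p e : ℕ) : Set where
  var    : Fin e → Exp p e
  leaf   : Exp p e
  node   : Exp p e → Exp p e → Exp p e
  let′   : Exp p e → Exp p (suc e) → Exp p e
  -- In the `node` branch, variable 0 is the left subtree and variable 1 the
  -- right subtree.
  case   : Exp p e → (leafBranch : Exp p e) (nodeBranch : Exp p (suc (suc e))) → Exp p e
  call   : Fin p → Exp p e → Exp p e

record Program : Set where
  field
    {size} : ℕ
    bodies : Vec (Exp size 1) size
    main   : Exp size 1

-- `Eval bs ρ a v t`: with function bodies bs and environment ρ, the
-- expression a evaluates to v in time t.

data Eval {p} (bs : Vec (Exp p 1) p) {e} (ρ : Vec Tree e) : Exp p e → Tree → ℕ → Set where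

  var  : ∀ {x} → Eval bs ρ (var x) (lookup ρ x) 1

  leaf : Eval bs ρ leaf leaf 1

  node : ∀ {a b v w s t} →
         Eval bs ρ a v s → Eval bs ρ b w t →
         Eval bs ρ (node a b) (node v w) (1 + s + t)

  let′ : ∀ {a b v w s t} →
         Eval bs ρ a v s → Eval bs (v ∷ ρ) b w t →
         Eval bs ρ (let′ a b) w (1 + s + t)

  case-leaf : ∀ {a b c w s t} →
              Eval bs ρ a leaf s → Eval bs ρ b w t →
              Eval bs ρ (case a b c) w (1 + s + t)

  case-node : ∀ {a b c u v w s t} →
              Eval bs ρ a (node u v) s → Eval bs (u ∷ v ∷ ρ) c w t →
              Eval bs ρ (case a b c) w (1 + s + t)

  call : ∀ {f a v w s t} →
         Eval bs ρ a v s → Eval bs (v ∷ []) (lookup bs f) w t →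
         Eval bs ρ (call f a) w (1 + s + t)

Eval-deterministic :
  ∀ {p} {bs : Vec (Exp p 1) p} {e} {ρ : Vec Tree e} {a v w s t} →
  Eval bs ρ a v s → Eval bs ρ a w t → v ≡ w × s ≡ t
Eval-deterministic var var = refl , refl
Eval-deterministic leaf leaf = refl , refl
Eval-deterministic (node d₁ d₂) (node e₁ e₂)
  with refl , refl ← Eval-deterministic d₁ e₁
  with refl , refl ← Eval-deterministic d₂ e₂ = refl , refl
Eval-deterministic (let′ d₁ d₂) (let′ e₁ e₂)
  with refl , refl ← Eval-deterministic d₁ e₁
  with refl , refl ← Eval-deterministic d₂ e₂ = refl , refl
Eval-deterministic (case-leaf d₁ d₂) (case-leaf e₁ e₂)
  with refl , refl ← Eval-deterministic d₁ e₁
  with refl , refl ← Eval-deterministic d₂ e₂ = refl , refl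
Eval-deterministic (case-leaf d₁ _) (case-node e₁ _)
  with () , _ ← Eval-deterministic d₁ e₁
Eval-deterministic (case-node d₁ _) (case-leaf e₁ _)
  with () , _ ← Eval-deterministic d₁ e₁
Eval-deterministic (case-node d₁ d₂) (case-node e₁ e₂)
  with refl , refl ← Eval-deterministic d₁ e₁
  with refl , refl ← Eval-deterministic d₂ e₂ = refl , refl
Eval-deterministic (call d₁ d₂) (call e₁ e₂)
  with refl , refl ← Eval-deterministic d₁ e₁
  with refl , refl ← Eval-deterministic d₂ e₂ = refl , refl

Run : Program → Tree → Tree → ℕ → Set
Run P input = Eval bodies (input ∷ []) main
  where open Program P

------------------------------------------------------------------------
-- Encoding of instances

⌜_⌝ᵇ : Bool → Tree
⌜ false ⌝ᵇ = leaf
⌜ true  ⌝ᵇ = node leaf leaf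

⌜_⌝ᵛ : ∀ {n} → Vec Tree n → Tree
⌜ []     ⌝ᵛ = leaf
⌜ t ∷ ts ⌝ᵛ = node t ⌜ ts ⌝ᵛ

⌜_⌝ˢ : ∀ {n} → Subset n → Tree
⌜ S ⌝ˢ = ⌜ map ⌜_⌝ᵇ S ⌝ᵛ

-- The adjacency matrix, as a list of rows.
⌜_⌝ᴳ : ∀ {n} → Graph n → Tree
⌜ G ⌝ᴳ = ⌜ tabulate (λ u → ⌜ tabulate (λ v → ⌜ Graph.adj G u v ⌝ᵇ) ⌝ᵛ) ⌝ᵛ

-- Numbers are given in binary, least significant digit first, in the
-- bijective numeration of ℕᵇ.
⌜_⌝ⁿ : ℕᵇ → Tree
⌜ ℕᵇ.zero  ⌝ⁿ = leaf
⌜ 2[1+ b ] ⌝ⁿ = node ⌜ true ⌝ᵇ ⌜ b ⌝ⁿ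
⌜ 1+[2 b ] ⌝ⁿ = node ⌜ false ⌝ᵇ ⌜ b ⌝ⁿ

encode : Instance → Tree
encode I = node ⌜ G ⌝ᴳ (node ⌜ X ⌝ˢ (node ⌜ Y ⌝ˢ ⌜ ℕᵇ.fromℕ k ⌝ⁿ))
  where open Instance I

treeSize : Tree → ℕ
treeSize leaf       = 1
treeSize (node l r) = 1 + treeSize l + treeSize r

inputSize : Instance → ℕ
inputSize I = treeSize (encode I)

------------------------------------------------------------------------
-- Deciding a problem within a time bound

data Answers (A : Set) : Tree → Set where
  yes : A → Answers A ⌜ true ⌝ᵇ
  no  : ¬ A → Answers A ⌜ false ⌝ᵇ

DecidesInTime : Program → (Instance → Set) → (Instance → ℕ) → Set
DecidesInTime P Problem bound =
  ∀ I → ∃₂ λ v t → Run P (encode I) v t × Answers (Problem I) v × t ≤ bound I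

-- A running time O*(2^f) is one of at most q · 2^f for a polynomial q of the
-- input size s; since s ≥ 1, the polynomial may be taken as c · s^d.
-- The exponent f = k − |X| − |Y| can be negative on valid instances (e.g.
-- k = 0 and X ∪ Y everything), where q · 2^f would fall below the time of a
-- single step; there it is read as 0, that is, as polynomial time.
exponent : Instance → ℕ
exponent I = k ∸ (∣ X ∣ + ∣ Y ∣)
  where open Instance I

{-# OPTIONS --safe #-}
module Submission where

-- Contracting G to a path amounts to a chain ∅ = L₀ ⊂ L₁ ⊂ … ⊂ L_ℓ = V with ℓ ≥ n − k in
-- which every bag W = L_{i+1} ∖ L_i is connected and no edge leaves L_i past W.  Layer by
-- layer the algorithm computes the family of all L reachable in i steps, stored as a binary
-- trie.  A bag W of a solution is found by branching: grow a connected set S from a start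
-- vertex, each time putting a vertex u next to S either into S or out of the game.  Such a u
-- lies in W or is adjacent to it, hence in one of three consecutive bags; and whether the
-- vertices of X and Y belong to W is guessed in advance (four modes), so they cause no
-- branching.  Since any five bags (these three and the two ends, which contain X ∪ Y) have at
-- most k + 5 vertices, the depth of the branching is at most k + 5 − |X| − |Y|.  Once W is
-- known, L is a connected component of G − W or the rest of G − W, so that each W yields
-- only two steps L → L ∪ W, each of which costs two operations on tries.

open import Defs hiding (yes; no)
open import Data.Bool.Base using (Bool; true; false; if_then_else_; not; _∧_; _∨_; T)
open import Data.Empty using (⊥-elim)
open import Data.Fin.Base using (Fin; zero; suc; toℕ; fromℕ; fromℕ<)
open import Data.Fin.Patterns
open import Data.Fin.Properties using (toℕ-injective; toℕ<n; toℕ-fromℕ; toℕ-fromℕ<; injective⇒≤; any?)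
  renaming (_≟_ to _≟ᶠ_)
open import Data.Fin.Subset
  using (Subset; _∈_; _∉_; _⊆_; _∪_; _∩_; _─_; ∁; ⊤; ⊥; ⁅_⁆; ∣_∣; Nonempty; Empty)
open import Data.Fin.Subset.Properties
open import Data.Nat.Base
open import Data.Nat.Binary.Base as ℕᵇ using (ℕᵇ; 2[1+_]; 1+[2_])
open import Data.Nat.Binary.Properties using () renaming (toℕ-fromℕ to toℕᵇ-fromℕᵇ)
open import Data.Nat.Properties
open import Data.Nat.Tactic.RingSolver using (solve-∀)
open import Data.Product.Base using (_×_; _,_; ∃; ∃₂; ∃-syntax; proj₁; proj₂)
open import Data.Sum.Base using (_⊎_; inj₁; inj₂; [_,_]′; map₁; map₂)
open import Data.Vec.Base using (Vec; []; _∷_; here; there; lookup; map; tabulate; zipWith; replicate)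
open import Data.Vec.Properties using (tabulate-∘; tabulate-cong; lookup∘tabulate; []=⇒lookup; lookup⇒[]=)
open import Function.Base using (_∘_; id)
open import Function.Bundles using (mk⇔; module Equivalence)
open import Relation.Binary.Construct.Closure.ReflexiveTransitive as Star using (Star; ε; _◅_; _◅◅_)
open import Relation.Binary.PropositionalEquality
open import Relation.Nullary.Decidable.Core using (yes; no)
open import Relation.Nullary.Negation.Core using (contradiction)

-- A layer may hold exponentially many sets, and running through it for every bag could add a second
-- exponential factor. A layer is therefore never enumerated: a bag determines its two candidates
-- for L, which are merely looked up. Only bags are enumerated, and rounds, modes and start vertices
-- are polynomial in number, so that the factor from the branching occurs once; the five extra units
-- of its depth cost a factor 32. Soundness and completeness draw on different facts. Whatever is
-- inserted has passed every test, so fuel and budget cannot cause a wrong positive answer; they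
-- only have to suffice for the bags of one solution, whose branching decisions are then followed.
-- That the number of contractions is at most k is never checked on the bags themselves but enforced
-- by the number of rounds in which layers are replaced rather than accumulated.

tcase : {A : Set} → Tree → A → (Tree → Tree → A) → A
tcase leaf       x f = x
tcase (node u v) x f = f u v

-- By definition these are what `val` makes of `fst` and `snd`, so that projections in the program
-- need no lemmas.
left right : Tree → Tree
left  t = tcase t leaf λ u _ → u
right t = tcase t leaf λ _ v → v

-- Inside the program a natural number (fuel, budget, …) is a list of that length whose
-- entries do not matter; spine reads it off.
spine : Tree → ℕ
spine leaf       = 0
spine (node _ t) = suc (spine t)

ones : ℕ → Tree
ones m = ⌜ ⊤ {m} ⌝ˢ

-- The program

p : ℕ
p = 17

-- The numbering is a topological order: a body calls only its own function and functions with
-- smaller numbers. Time bounds can thus be computed by recursion on the number.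
pattern #select       = 0F
pattern #zip          = 1F
pattern #any          = 2F
pattern #first        = 3F
pattern #neighbours   = 4F
pattern #closure      = 5F
pattern #member       = 6F
pattern #insert       = 7F
pattern #discount     = 8F
pattern #cappedDouble = 9F
pattern #toUnary      = suc 9F
pattern #try          = suc (suc 9F)
pattern #process      = suc (suc (suc 9F))
pattern #branch       = suc (suc (suc (suc 9F)))
pattern #starts       = suc (suc (suc (suc (suc 9F))))
pattern #mode         = suc (suc (suc (suc (suc (suc 9F)))))
pattern #rounds       = suc (suc (suc (suc (suc (suc (suc 9F))))))

module _ {e : ℕ} where

  v0 : Exp p (1 + e)
  v0 = var 0F

  v1 : Exp p (2 + e)
  v1 = var 1F

  v2 : Exp p (3 + e)
  v2 = var 2F

  v3 : Exp p (4 + e)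
  v3 = var 3F

  v4 : Exp p (5 + e)
  v4 = var 4F

  v5 : Exp p (6 + e)
  v5 = var 5F

  v6 : Exp p (7 + e)
  v6 = var 6F

  tru : Exp p e
  tru = node leaf leaf

  fst snd snd² snd³ snd⁴ snd⁵ snd⁶ : Exp p e → Exp p e
  fst a = case a leaf (var 0F)
  snd a = case a leaf (var 1F)
  snd² a = snd (snd a)
  snd³ a = snd (snd² a)
  snd⁴ a = snd (snd³ a)
  snd⁵ a = snd (snd⁴ a)
  snd⁶ a = snd (snd⁵ a)

  constᵇ : Bool → Exp p e
  constᵇ false = leaf
  constᵇ true  = tru

  -- Passing a truth table as data lets the single function `zip` serve all Boolean operations on
  -- sets.
  table : (Bool → Bool → Bool) → Exp p e
  table f = node (node (constᵇ (f false false)) (constᵇ (f false true)))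
                 (node (constᵇ (f true false)) (constᵇ (f true true)))

  -- Unlike case, this evaluates both alternatives, but it does not extend the environment.
  selectE : Exp p e → Exp p e → Exp p e
  selectE b t = call #select (node b t)

  zipE : (Bool → Bool → Bool) → Exp p e → Exp p e → Exp p e
  zipE f a b = call #zip (node (table f) (node a b))

  unionE interE minusE : Exp p e → Exp p e → Exp p e
  unionE = zipE _∨_
  interE = zipE _∧_
  minusE = zipE λ x y → x ∧ not y

  -- A constant set must have the right length, which it inherits from `a` by zipping `a` with
  -- itself.
  complE emptyE fullE anyE firstE : Exp p e → Exp p e
  complE a = zipE (λ x _ → not x) a a
  emptyE a = zipE (λ _ _ → false) a a
  fullE  a = zipE (λ _ _ → true) a a
  anyE     = call #any
  firstE   = call #first

  memberE insertE discountE : Exp p e → Exp p e → Exp p e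
  memberE a b = call #member (node a b)
  insertE  a b = call #insert (node a b)
  discountE  a b = call #discount (node a b)

  neighboursE processE : Exp p e → Exp p e → Exp p e → Exp p e
  neighboursE a b c = call #neighbours (node a (node b c))
  processE a b c = call #process (node a (node b c))

  closureE tryE modeE : Exp p e → Exp p e → Exp p e → Exp p e → Exp p e
  closureE a b c d = call #closure (node a (node b (node c d)))
  tryE a b c d = call #try (node a (node b (node c d)))
  modeE a b c d = call #mode (node a (node b (node c d)))

  branchE : Exp p e → Exp p e → Exp p e → Exp p e → Exp p e → Exp p e → Exp p e → Exp p e
  branchE a b c d f g h = call #branch (node a (node b (node c (node d (node f (node g h))))))

  startsE : Exp p e → Exp p e → Exp p e → Exp p e → Exp p e → Exp p e → Exp p e
  startsE a b c d f g = call #starts (node a (node b (node c (node d (node f g)))))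

  stepE : Exp p e → Exp p e → Exp p e → Exp p e
  stepE β c acc =
    modeE (emptyE X) β c (modeE X β c (modeE Y β c (modeE (unionE X Y) β c acc)))
    where X = fst (snd c)
          Y = fst (snd² c)

-- A function of several arguments receives them as a right-nested tuple, which is the last
-- variable of the environment throughout its body.

select-body zip-body any-body first-body neighbours-body closure-body member-body
  insert-body discount-body cappedDouble-body toUnary-body try-body process-body branch-body
  starts-body mode-body rounds-body : Exp p 1

select-body = case (fst v0) (fst (snd v0)) (snd (snd v2))

zip-body = case (fst (snd v0)) leaf
  (node (selectE (fst (snd² v2)) (selectE v0 (fst v2)))
        (call #zip (node (fst v2) (node v1 (snd³ v2)))))

any-body = case v0 leaf (case v0 (anyE v1) tru)

first-body = case v0 leaf
  (case v0 (node leaf (firstE v1)) (node tru (emptyE v3)))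

neighbours-body = case (fst v0) (snd² v0)
  (neighboursE v1 (snd (fst (snd v2)))
     (selectE (fst (fst (snd v2))) (node (snd² v2) (unionE v0 (snd² v2)))))

closure-body = case (fst v0) (fst (snd v0))
  (call #closure (node v1
     (node (interE (neighboursE (fst (snd² v2)) (fst (snd v2)) (fst (snd v2))) (snd³ v2))
           (snd² v2))))

member-body = case (fst v0) (case (snd v0) leaf tru) (memberE v1 (selectE v0 (snd v2)))

insert-body = case (fst v0) tru
  (case v0 (node (insertE v1 (fst (snd v2))) (snd (snd v2)))
           (node (fst (snd v4)) (insertE v3 (snd (snd v4)))))

discount-body = case (fst v0) (snd v0) (discountE v1 (selectE v0 (node (snd v2) (snd (snd v2)))))

cappedDouble-body = case (fst v0) leaf
  (case (snd v2) leaf (node tru (node tru (call #cappedDouble (node v3 v1)))))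

toUnary-body = case (snd v0) leaf
  (let′ (call #cappedDouble (node (fst v2) (call #toUnary (node (fst v2) v1))))
    (node tru (selectE v1 (node v0 (node tru v0)))))

try-body = case (anyE (minusE (X v0) (unionE (L v0) (W v0))))
  (case (anyE (interE (Y v0) (L v0)))
    (case (memberE (L v0) (T′ v0)) (acc v0) (insertE (unionE (L v2) (W v2)) (acc v2)))
    (acc v2))
  (acc v2)
  where
  L W X Y T′ acc : ∀ {e} → Exp p e → Exp p e
  L a = fst a
  W a = fst (snd a)
  X a = fst (snd (fst (snd² a)))
  Y a = fst (snd² (fst (snd² a)))
  T′ a = snd³ (fst (snd² a))
  acc a = snd³ a

process-body = case (anyE (W v0)) (acc v0)
  (let′ (complE (W v2))
  (let′ (closureE (X v3) (firstE v0) (A v3) v0)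
  (tryE v0 (W v4) (ctx v4) (tryE (minusE v1 v0) (W v4) (ctx v4) (acc v4)))))
  where
  W ctx A X acc : ∀ {e} → Exp p e → Exp p e
  W a = fst a
  ctx a = fst (snd a)
  A a = fst (ctx a)
  X a = fst (snd (ctx a))
  acc a = snd² a

branch-body = case (fst v0) (processE (S v0) (ctx v0) (acc v0))
  (let′ (processE (S v2) (ctx v2) (acc v2))
  (let′ (firstE (interE (neighboursE (A v3) (S v3) (S v3)) (U v3)))
  (case (anyE (interE v0 (F v4)))
    (case (β v4) v1
      (branchE v5 v1 (F v6) (unionE (S v6) v2) (minusE (U v6) v2) (ctx v6)
        (branchE v5 v1 (F v6) (S v6) (minusE (U v6) v2) (ctx v6) v3)))
    (branchE v5 (β v6) (F v6) (unionE (S v6) v2) (minusE (U v6) v2) (ctx v6) v3))))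
  where
  β F S U ctx A acc : ∀ {e} → Exp p e → Exp p e
  β a = fst (snd a)
  F a = fst (snd² a)
  S a = fst (snd³ a)
  U a = fst (snd⁴ a)
  ctx a = fst (snd⁵ a)
  A a = fst (ctx a)
  acc a = snd⁶ a

starts-body = case (fst v0) (acc v0)
  (let′ (firstE (R v2))
  (let′ (minusE (R v3) v0)
  (branchE (X v4) (β v4) (F v4) v1 v0 (ctx v4)
    (startsE v3 v0 (β v4) (F v4) (ctx v4) (acc v4)))))
  where
  R β F ctx X acc : ∀ {e} → Exp p e → Exp p e
  R a = fst (snd a)
  β a = fst (snd² a)
  F a = fst (snd³ a)
  ctx a = fst (snd⁴ a)
  X a = fst (snd (ctx a))
  acc a = snd⁵ a

mode-body = startsE (X v0) (zipE (λ x y → x ∨ not y) (fst v0) (unionE (X v0) (Y v0)))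
                (fst (snd v0)) (fst v0) (ctx v0) (snd³ v0)
  where
  ctx X Y : ∀ {e} → Exp p e → Exp p e
  ctx a = fst (snd² a)
  X a = fst (snd (ctx a))
  Y a = fst (snd² (ctx a))

rounds-body = case (fst v0) (T′ v0)
  (call #rounds (node v1 (node (snd (ρ v2)) (node (β v2) (node (g v2)
    (stepE (β v2) (node (fst (g v2)) (node (fst (snd (g v2))) (node (snd² (g v2)) (T′ v2))))
           (case (ρ v2) (T′ v2) leaf)))))))
  where
  ρ β g T′ : ∀ {e} → Exp p e → Exp p e
  ρ a = fst (snd a)
  β a = fst (snd² a)
  g a = fst (snd³ a)
  T′ a = snd⁴ a

bs : Vec (Exp p 1) p
bs = select-body ∷ zip-body ∷ any-body ∷ first-body ∷ neighbours-body ∷ closure-body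
   ∷ member-body ∷ insert-body ∷ discount-body ∷ cappedDouble-body ∷ toUnary-body ∷ try-body
   ∷ process-body ∷ branch-body ∷ starts-body ∷ mode-body ∷ rounds-body ∷ []

-- After the let, variable 0 is k capped at about n, in unary: k itself may be exponentially
-- large in the size of its encoding.
main-body : Exp p 1
main-body = let′ (call #toUnary (node (X v0) (snd³ v0)))
  (memberE (fullE (X v1))
    (call #rounds
      (node (X v1)
      -- Here `X` is just a list of length `n`; removing the capped `k` leaves the least number of
      -- bags of a solution.
      (node (discountE v0 (X v1))
      (node (discountE (Y v1)
              (discountE (X v1) (node tru (node tru (node tru (node tru (node tru v0)))))))
      (node (node (fst v1) (node (X v1) (Y v1)))
            (insertE (emptyE (X v1)) leaf)))))))
  where
  X Y : ∀ {e} → Exp p e → Exp p e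
  X a = fst (snd a)
  Y a = fst (snd² a)

-- What the functions compute on encoded arguments

any : ∀ {m} → Subset m → Bool
any []      = false
any (b ∷ S) = if b then true else any S

first : ∀ {m} → Subset m → Subset m
first []      = []
first (b ∷ S) = if b then true ∷ ⊥ else false ∷ first S

neighbours : ∀ {m n} → Vec (Subset n) m → Subset m → Subset n → Subset n
neighbours []       []      A = A
neighbours (r ∷ rs) (b ∷ S) A = neighbours rs S (if b then r ∪ A else A)

-- Families of subsets are binary tries.  A leaf stands for the empty family at every depth;
-- it is its own left and right subtree.
member : ∀ {m} → Subset m → Tree → Bool
member []      t = tcase t false λ _ _ → true
member (b ∷ S) t = member S (if b then right t else left t)

insert : ∀ {m} → Subset m → Tree → Tree
insert []      t = node leaf leaf
insert (b ∷ S) t = if b then node (left t) (insert S (right t)) else node (insert S (left t)) (right t)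

discount : ∀ {m} → Subset m → Tree → Tree
discount []      t = t
discount (b ∷ S) t = discount S (if b then right t else t)

cappedDouble : ℕ → ℕ → ℕ
cappedDouble zero    m       = 0
cappedDouble (suc c) zero    = 0
cappedDouble (suc c) (suc m) = 2 + cappedDouble c m

toUnary : ℕ → ℕᵇ → ℕ
toUnary c ℕᵇ.zero  = 0
toUnary c 2[1+ b ] = 2 + cappedDouble c (toUnary c b)
toUnary c 1+[2 b ] = 1 + cappedDouble c (toUnary c b)

⌜_⌝ᵗ : (Bool → Bool → Bool) → Tree
⌜ f ⌝ᵗ = node (node ⌜ f false false ⌝ᵇ ⌜ f false true ⌝ᵇ) (node ⌜ f true false ⌝ᵇ ⌜ f true true ⌝ᵇ)

module _ (I : Instance) where

  open Instance I

  rows : Vec (Subset n) n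
  rows = tabulate λ u → tabulate (Graph.adj G u)

  ⌜rows⌝ : Tree
  ⌜rows⌝ = ⌜ map ⌜_⌝ˢ rows ⌝ᵛ

  closure : Tree → Subset n → Subset n → Subset n
  closure leaf       S C = S
  closure (node _ φ) S C = closure φ (neighbours rows S S ∩ C) C

  -- T is the current layer of unions of bags, acc the next one under construction.
  try : Subset n → Subset n → Tree → Tree → Tree
  try L W T acc =
    if any (X ─ (L ∪ W)) then acc else
    if any (Y ∩ L) then acc else
    if member L T then insert (L ∪ W) acc else acc

  component : Subset n → Subset n
  component W = closure ⌜ X ⌝ˢ (first (∁ W)) (∁ W)

  process : Subset n → Tree → Tree → Tree
  process W T acc =
    if any W then try (component W) W T (try (∁ W ─ component W) W T acc) else acc

  -- When there is nothing to pick this is empty, and `branch` idles until fuel or budget runs out;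
  -- its time bound allows for that.
  pick : Subset n → Subset n → Subset n
  pick S U = first (neighbours rows S S ∩ U)

  -- Arguments: fuel, budget, vertices forced into the bag, the part S of the bag found so far
  -- and the undecided vertices U.  Every S on the way is processed, being connected.
  branch : Tree → Tree → Subset n → Subset n → Subset n → Tree → Tree → Tree
  branch leaf β F S U T acc = process S T acc
  branch (node _ φ) leaf F S U T acc =
    if any (pick S U ∩ F)
    then branch φ leaf F (S ∪ pick S U) (U ─ pick S U) T (process S T acc)
    else process S T acc
  branch (node _ φ) (node x β) F S U T acc =
    if any (pick S U ∩ F)
    then branch φ (node x β) F (S ∪ pick S U) (U ─ pick S U) T (process S T acc)
    else branch φ β F (S ∪ pick S U) (U ─ pick S U) T
           (branch φ β F S (U ─ pick S U) T (process S T acc))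

  -- A bag is grown from its first vertex in `R`: vertices that served as starts before are no
  -- longer candidates.
  starts : Tree → Subset n → Tree → Subset n → Tree → Tree → Tree
  starts leaf R β F T acc = acc
  starts (node _ φ) R β F T acc =
    branch ⌜ X ⌝ˢ β F (first R) (R ─ first R) T (starts φ (R ─ first R) β F T acc)

  mode : Subset n → Tree → Tree → Tree → Tree
  mode F β T acc = starts ⌜ X ⌝ˢ (F ∪ ∁ (X ∪ Y)) β F T acc

  step : Tree → Tree → Tree → Tree
  step β T acc = mode ⊥ β T (mode X β T (mode Y β T (mode (X ∪ Y) β T acc)))

  -- ρ counts the steps that a solution must still make; once there are none, layers
  -- accumulate, so that longer chains are found as well.
  rounds : Tree → Tree → Tree → Tree → Tree
  rounds leaf       ρ β T = T
  rounds (node _ φ) ρ β T = rounds φ (right ρ) β (step β T (tcase ρ T λ _ _ → leaf))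

  maxBudget : ℕ
  maxBudget = 5 + exponent I

  ctx : Tree → Tree
  ctx T = node ⌜rows⌝ (node ⌜ X ⌝ˢ (node ⌜ Y ⌝ˢ T))

  -- Call f μ v w: function f may be called with v and then returns w, within μ times the
  -- time of its body without the recursive calls.  For this it suffices that the μ of these
  -- calls add up to less than μ.
  data Call : Fin p → ℕ → Tree → Tree → Set where
    selectᶜ : ∀ b t → Call #select 1 (node ⌜ b ⌝ᵇ t) (if b then right t else left t)
    zipᶜ : ∀ {m} → m ≤ inputSize I → ∀ f (S T : Subset m) →
          Call #zip (suc m) (node ⌜ f ⌝ᵗ (node ⌜ S ⌝ˢ ⌜ T ⌝ˢ)) ⌜ zipWith f S T ⌝ˢ
    anyᶜ : ∀ {m} → m ≤ inputSize I → (S : Subset m) → Call #any (suc m) ⌜ S ⌝ˢ ⌜ any S ⌝ᵇ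
    firstᶜ : ∀ {m} → m ≤ inputSize I → (S : Subset m) → Call #first (suc m) ⌜ S ⌝ˢ ⌜ first S ⌝ˢ
    neighboursᶜ : ∀ {m} → m ≤ inputSize I → (rs : Vec (Subset n) m) (S : Subset m) (A : Subset n) →
         Call #neighbours (suc m) (node ⌜ map ⌜_⌝ˢ rs ⌝ᵛ (node ⌜ S ⌝ˢ ⌜ A ⌝ˢ)) ⌜ neighbours rs S A ⌝ˢ
    closureᶜ : ∀ φ S C → spine φ ≤ inputSize I →
           Call #closure (suc (spine φ)) (node φ (node ⌜ S ⌝ˢ (node ⌜rows⌝ ⌜ C ⌝ˢ))) ⌜ closure φ S C ⌝ˢ
    memberᶜ : ∀ {m} → m ≤ inputSize I → (S : Subset m) (t : Tree) →
           Call #member (suc m) (node ⌜ S ⌝ˢ t) ⌜ member S t ⌝ᵇ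
    insertᶜ : ∀ {m} → m ≤ inputSize I → (S : Subset m) (t : Tree) →
          Call #insert (suc m) (node ⌜ S ⌝ˢ t) (insert S t)
    discountᶜ : ∀ {m} → m ≤ 2 + inputSize I + inputSize I → (S : Subset m) (t : Tree) →
          Call #discount (suc m) (node ⌜ S ⌝ˢ t) (discount S t)
    cappedDoubleᶜ : ∀ {c} → c ≤ inputSize I → (S : Subset c) (m : ℕ) →
          Call #cappedDouble (suc c) (node ⌜ S ⌝ˢ (ones m)) (ones (cappedDouble c m))
    toUnaryᶜ : ∀ b → ℕᵇ.size b ≤ inputSize I →
           Call #toUnary (suc (ℕᵇ.size b)) (node ⌜ X ⌝ˢ ⌜ b ⌝ⁿ) (ones (toUnary n b))
    tryᶜ : ∀ L W T acc →
          Call #try 1 (node ⌜ L ⌝ˢ (node ⌜ W ⌝ˢ (node (ctx T) acc))) (try L W T acc)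
    processᶜ : ∀ W T acc → Call #process 1 (node ⌜ W ⌝ˢ (node (ctx T) acc)) (process W T acc)
    branchᶜ : ∀ φ β F S U T acc → spine φ ≤ inputSize I → spine β ≤ maxBudget →
          Call #branch (suc (spine φ) * 2 ^ spine β)
            (node φ (node β (node ⌜ F ⌝ˢ (node ⌜ S ⌝ˢ (node ⌜ U ⌝ˢ (node (ctx T) acc))))))
            (branch φ β F S U T acc)
    startsᶜ : ∀ φ R β F T acc → spine φ ≤ inputSize I → spine β ≤ maxBudget →
             Call #starts (suc (spine φ))
               (node φ (node ⌜ R ⌝ˢ (node β (node ⌜ F ⌝ˢ (node (ctx T) acc)))))
               (starts φ R β F T acc)
    modeᶜ : ∀ F β T acc → spine β ≤ maxBudget →
           Call #mode 1 (node ⌜ F ⌝ˢ (node β (node (ctx T) acc))) (mode F β T acc)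
    roundsᶜ : ∀ φ ρ β T → spine φ ≤ inputSize I → spine β ≤ maxBudget →
             Call #rounds (suc (spine φ))
               (node φ (node ρ (node β (node (node ⌜rows⌝ (node ⌜ X ⌝ˢ ⌜ Y ⌝ˢ)) T))))
               (rounds φ ρ β T)

  -- Evaluation inside the body of function i.  The last index adds up the μ of the recursive
  -- calls.
  data Sem (i : ℕ) {e} (ρ : Vec Tree e) : Exp p e → Tree → ℕ → Set where
    var⇓ : ∀ {x} → Sem i ρ (var x) (lookup ρ x) 0
    leaf⇓ : Sem i ρ leaf leaf 0
    node⇓ : ∀ {a b v w q r} → Sem i ρ a v q → Sem i ρ b w r → Sem i ρ (node a b) (node v w) (q + r)
    let⇓ : ∀ {a b v w q r} → Sem i ρ a v q → Sem i (v ∷ ρ) b w r → Sem i ρ (let′ a b) w (q + r)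
    case-leaf⇓ : ∀ {a b c w q r} →
      Sem i ρ a leaf q → Sem i ρ b w r → Sem i ρ (case a b c) w (q + r)
    case-node⇓ : ∀ {a b c u v w q r} →
      Sem i ρ a (node u v) q → Sem i (u ∷ v ∷ ρ) c w r → Sem i ρ (case a b c) w (q + r)
    call⇓ : ∀ {g a v w q μ} {lt : T (toℕ g <ᵇ i)} →
      Sem i ρ a v q → Call g μ v w → Sem i ρ (call g a) w q
    self⇓ : ∀ {g a v w q μ} → Sem i ρ a v q → toℕ g ≡ i → Call g μ v w → Sem i ρ (call g a) w (q + μ)

-- Derivations in Sem

isSimple : ∀ {e} → Exp p e → Bool
isSimple (var x)      = true
isSimple leaf         = true
isSimple (node a b)   = isSimple a ∧ isSimple b
isSimple (let′ a b)   = false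
isSimple (case a b c) = isSimple a ∧ (isSimple b ∧ isSimple c)
isSimple (call f a)   = false

-- Junk (leaf) on expressions that are not simple.
val : ∀ {e} → Exp p e → Vec Tree e → Tree
val (var x)      ρ = lookup ρ x
val leaf         ρ = leaf
val (node a b)   ρ = node (val a ρ) (val b ρ)
val (let′ a b)   ρ = leaf
val (case a b c) ρ = tcase (val a ρ) (val b ρ) λ u v → val c (u ∷ v ∷ ρ)
val (call f a)   ρ = leaf

∧-T : ∀ {a b} → T (a ∧ b) → T a × T b
∧-T {true} t = _ , t

zip-∁ : ∀ {m} (S : Subset m) → zipWith (λ x _ → not x) S S ≡ ∁ S
zip-∁ []      = refl
zip-∁ (b ∷ S) = cong (_ ∷_) (zip-∁ S)

zip-const : ∀ {m} (b : Bool) (S : Subset m) → zipWith (λ _ _ → b) S S ≡ replicate m b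
zip-const b []      = refl
zip-const b (_ ∷ S) = cong (b ∷_) (zip-const b S)

zip-─ : ∀ {m} (S U : Subset m) → zipWith (λ x y → x ∧ not y) S U ≡ S ─ U
zip-─ []      []            = refl
zip-─ (false ∷ S) (false ∷ U) = cong (_ ∷_) (zip-─ S U)
zip-─ (false ∷ S) (true ∷ U) = cong (_ ∷_) (zip-─ S U)
zip-─ (true ∷ S) (false ∷ U) = cong (_ ∷_) (zip-─ S U)
zip-─ (true ∷ S) (true ∷ U) = cong (_ ∷_) (zip-─ S U)

zip-∪∁ : ∀ {m} (S U : Subset m) → zipWith (λ x y → x ∨ not y) S U ≡ S ∪ ∁ U
zip-∪∁ []      []      = refl
zip-∪∁ (_ ∷ S) (_ ∷ U) = cong (_ ∷_) (zip-∪∁ S U)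

spine-⌜⌝ : ∀ {m} (S : Subset m) → spine ⌜ S ⌝ˢ ≡ m
spine-⌜⌝ []      = refl
spine-⌜⌝ (_ ∷ S) = cong suc (spine-⌜⌝ S)

module _ (I : Instance) where

  open Instance I

  simple : ∀ {i e} {ρ : Vec Tree e} (a : Exp p e) → T (isSimple a) → Sem I i ρ a (val a ρ) 0
  simple (var x)    t = var⇓
  simple leaf       t = leaf⇓
  simple (node a b) t = node⇓ (simple a (proj₁ (∧-T {isSimple a} t))) (simple b (proj₂ (∧-T {isSimple a} t)))
  simple {ρ = ρ} (case a b c) t
    with ta , tbc ← ∧-T {isSimple a} t
    with tb , tc ← ∧-T {isSimple b} tbc
    with val a ρ | simple {ρ = ρ} a ta
  ... | leaf     | d = case-leaf⇓ d (simple b tb)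
  ... | node u v | d = case-node⇓ d (simple c tc)

  n≤N : n ≤ inputSize I
  n≤N = ≤-trans (lemma X)
          (≤-trans (m≤m+n (treeSize ⌜ X ⌝ˢ) _)
            (≤-trans (n≤1+n _) (≤-trans (m≤n+m _ (treeSize ⌜ G ⌝ᴳ)) (n≤1+n _))))
    where
    lemma : ∀ {m} (S : Subset m) → m ≤ treeSize ⌜ S ⌝ˢ
    lemma []      = z≤n
    lemma (b ∷ S) = s≤s (≤-trans (lemma S) (m≤n+m _ (treeSize ⌜ b ⌝ᵇ)))

  spineX≤N : spine ⌜ X ⌝ˢ ≤ inputSize I
  spineX≤N rewrite spine-⌜⌝ X = n≤N

  module _ {i e : ℕ} {ρ : Vec Tree e} where

    -- Reflection: for a concrete expression without calls the side condition computes to the unit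
    -- type and is filled in silently.
    ✓ : {a : Exp p e} {_ : T (isSimple a)} → Sem I i ρ a (val a ρ) 0
    ✓ {a} {t} = simple a t

    ≡⇓ : ∀ {a v w q} → v ≡ w → Sem I i ρ a v q → Sem I i ρ a w q
    ≡⇓ refl d = d

    if⇓ : ∀ {a x y w₁ w₂ q r} b → Sem I i ρ a ⌜ b ⌝ᵇ q → Sem I i ρ x w₁ r →
          Sem I i (leaf ∷ leaf ∷ ρ) y w₂ r →
          Sem I i ρ (case a x y) (if b then w₂ else w₁) (q + r)
    if⇓ false d d₁ d₂ = case-leaf⇓ d d₁
    if⇓ true  d d₁ d₂ = case-node⇓ d d₂

    select⇓ : ∀ {a c t} {lt : T (0 <ᵇ i)} b → Sem I i ρ a ⌜ b ⌝ᵇ 0 → Sem I i ρ c t 0 →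
           Sem I i ρ (selectE a c) (if b then right t else left t) 0
    select⇓ {lt = lt} b d₁ d₂ = call⇓ {lt = lt} (node⇓ d₁ d₂) (selectᶜ b _)

    bool⇓ : ∀ b → Sem I i ρ (constᵇ b) ⌜ b ⌝ᵇ 0
    bool⇓ false = leaf⇓
    bool⇓ true  = ✓

    zip⇓ : ∀ {m a c R} {lt : T (1 <ᵇ i)} {S U : Subset m} f → zipWith f S U ≡ R → m ≤ inputSize I →
           Sem I i ρ a ⌜ S ⌝ˢ 0 → Sem I i ρ c ⌜ U ⌝ˢ 0 → Sem I i ρ (zipE f a c) ⌜ R ⌝ˢ 0
    zip⇓ {lt = lt} f refl m≤N d₁ d₂ = call⇓ {lt = lt}
      (node⇓ (node⇓ (node⇓ (bool⇓ _) (bool⇓ _)) (node⇓ (bool⇓ _) (bool⇓ _))) (node⇓ d₁ d₂))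
      (zipᶜ m≤N f _ _)

  pick⇓ : ∀ {i e} {ρ : Vec Tree e} {a b c} {S U : Subset n}
          {lt₁ : T (1 <ᵇ i)} {lt₃ : T (3 <ᵇ i)} {lt₄ : T (4 <ᵇ i)} →
          Sem I i ρ a (⌜rows⌝ I) 0 → Sem I i ρ b ⌜ S ⌝ˢ 0 → Sem I i ρ c ⌜ U ⌝ˢ 0 →
          Sem I i ρ (firstE (interE (neighboursE a b b) c)) ⌜ pick I S U ⌝ˢ 0
  pick⇓ {S = S} {U} {lt₁} {lt₃} {lt₄} d₁ d₂ d₃ =
    call⇓ {lt = lt₃} (zip⇓ {lt = lt₁} {S = neighbours (rows I) S S} {U = U} _ refl n≤N
        (call⇓ {lt = lt₄} (node⇓ d₁ (node⇓ d₂ d₂)) (neighboursᶜ n≤N (rows I) S S)) d₃)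
      (firstᶜ n≤N _)

  -- Evaluating the function bodies

  Body : Fin p → ℕ → Tree → Tree → Set
  Body f μ v w = ∃ λ q → Sem I (toℕ f) (v ∷ []) (lookup bs f) w q × q < μ

  last : ∀ {m} → m + 0 < suc m
  last {m} = s≤s (≤-reflexive (+-identityʳ m))

  -- The functions on subsets follow the program clause by clause, so a case distinction on their
  -- arguments fixes every branch that the body takes.
  body : ∀ {f μ v w} → Call I f μ v w → Body f μ v w
  body (selectᶜ false t) = _ , case-leaf⇓ ✓ ✓ , ≤-refl
  body (selectᶜ true t)  = _ , case-node⇓ ✓ ✓ , ≤-refl
  body (zipᶜ _ f [] []) = _ , case-leaf⇓ ✓ leaf⇓ , s≤s z≤n
  body (zipᶜ m≤N f (b ∷ S) (c ∷ U)) =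
    _ , case-node⇓ ✓ (node⇓ (≡⇓ (eq b c) (select⇓ c ✓ (select⇓ b ✓ ✓)))
                            (self⇓ ✓ refl (zipᶜ (<⇒≤ m≤N) f S U)))
      , ≤-refl
    where
    eq : ∀ b c → (let r = if b then right ⌜ f ⌝ᵗ else left ⌜ f ⌝ᵗ in if c then right r else left r) ≡ ⌜ f b c ⌝ᵇ
    eq false false = refl
    eq false true = refl
    eq true false = refl
    eq true true = refl
  body (anyᶜ _ []) = _ , case-leaf⇓ ✓ leaf⇓ , s≤s z≤n
  body (anyᶜ m≤N (false ∷ S)) =
    _ , case-node⇓ ✓ (case-leaf⇓ ✓ (self⇓ ✓ refl (anyᶜ (<⇒≤ m≤N) S))) , ≤-refl
  body (anyᶜ _ (true ∷ S)) = _ , case-node⇓ ✓ (case-node⇓ ✓ ✓) , s≤s z≤n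
  body (firstᶜ _ []) = _ , case-leaf⇓ ✓ leaf⇓ , s≤s z≤n
  body (firstᶜ m≤N (false ∷ S)) =
    _ , case-node⇓ ✓ (case-leaf⇓ ✓ (node⇓ ✓ (self⇓ ✓ refl (firstᶜ (<⇒≤ m≤N) S)))) , ≤-refl
  body (firstᶜ m≤N (true ∷ S)) =
    _ , case-node⇓ ✓ (case-node⇓ ✓ (node⇓ ✓ (zip⇓ _ (zip-const false S) (<⇒≤ m≤N) ✓ ✓))) , s≤s z≤n
  body (neighboursᶜ _ [] [] A) = _ , case-leaf⇓ ✓ ✓ , s≤s z≤n
  body (neighboursᶜ m≤N (r ∷ rs) (b ∷ S) A) =
    _ , case-node⇓ ✓ (self⇓
          (node⇓ ✓ (node⇓ ✓ (≡⇓ (eq b)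
            (select⇓ b ✓ (node⇓ ✓ (zip⇓ {S = r} {U = A} _ refl n≤N ✓ ✓))))))
          refl (neighboursᶜ (<⇒≤ m≤N) rs S (if b then r ∪ A else A))) , ≤-refl
    where
    eq : ∀ b → (if b then ⌜ r ∪ A ⌝ˢ else ⌜ A ⌝ˢ) ≡ ⌜ if b then r ∪ A else A ⌝ˢ
    eq false = refl
    eq true  = refl
  body (closureᶜ leaf S C _) = _ , case-leaf⇓ ✓ ✓ , s≤s z≤n
  body (closureᶜ (node _ φ) S C φ≤N) =
    _ , case-node⇓ ✓ (self⇓
          (node⇓ ✓ (node⇓ (zip⇓ {U = C} _ refl n≤N (call⇓ ✓ (neighboursᶜ n≤N (rows I) S S)) ✓) ✓))
          refl (closureᶜ φ (neighbours (rows I) S S ∩ C) C (<⇒≤ φ≤N))) , ≤-refl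
  body (memberᶜ _ [] leaf) = _ , case-leaf⇓ ✓ (case-leaf⇓ ✓ leaf⇓) , s≤s z≤n
  body (memberᶜ _ [] (node _ _)) = _ , case-leaf⇓ ✓ (case-node⇓ ✓ ✓) , s≤s z≤n
  body (memberᶜ m≤N (b ∷ S) t) =
    _ , case-node⇓ ✓ (self⇓ (node⇓ ✓ (select⇓ b ✓ ✓)) refl
          (memberᶜ (<⇒≤ m≤N) S (if b then right t else left t))) , ≤-refl
  body (insertᶜ _ [] t) = _ , case-leaf⇓ ✓ ✓ , s≤s z≤n
  body (insertᶜ m≤N (false ∷ S) t) =
    _ , case-node⇓ ✓ (case-leaf⇓ ✓ (node⇓ (self⇓ ✓ refl (insertᶜ (<⇒≤ m≤N) S (left t))) ✓)) , last
  body (insertᶜ m≤N (true ∷ S) t) =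
    _ , case-node⇓ ✓ (case-node⇓ ✓ (node⇓ ✓ (self⇓ ✓ refl (insertᶜ (<⇒≤ m≤N) S (right t))))) , ≤-refl
  body (discountᶜ _ [] t) = _ , case-leaf⇓ ✓ ✓ , s≤s z≤n
  body (discountᶜ m≤N (b ∷ S) t) =
    _ , case-node⇓ ✓ (self⇓ (node⇓ ✓ (select⇓ b ✓ ✓)) refl
          (discountᶜ (<⇒≤ m≤N) S (if b then right t else t))) , ≤-refl
  body (cappedDoubleᶜ _ [] m) = _ , case-leaf⇓ ✓ leaf⇓ , s≤s z≤n
  body (cappedDoubleᶜ _ (b ∷ S) zero) = _ , case-node⇓ ✓ (case-leaf⇓ ✓ leaf⇓) , s≤s z≤n
  body (cappedDoubleᶜ m≤N (b ∷ S) (suc m)) =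
    _ , case-node⇓ ✓ (case-node⇓ ✓ (node⇓ ✓ (node⇓ ✓ (self⇓ ✓ refl (cappedDoubleᶜ (<⇒≤ m≤N) S m))))) , ≤-refl
  body (toUnaryᶜ ℕᵇ.zero _) = _ , case-leaf⇓ ✓ leaf⇓ , s≤s z≤n
  body (toUnaryᶜ 2[1+ b ] b≤N) =
    _ , case-node⇓ ✓ (let⇓ (call⇓ (node⇓ ✓ (self⇓ ✓ refl (toUnaryᶜ b (<⇒≤ b≤N))))
                               (cappedDoubleᶜ n≤N X (toUnary n b)))
          (node⇓ ✓ (select⇓ true ✓ ✓))) , last
  body (toUnaryᶜ 1+[2 b ] b≤N) =
    _ , case-node⇓ ✓ (let⇓ (call⇓ (node⇓ ✓ (self⇓ ✓ refl (toUnaryᶜ b (<⇒≤ b≤N))))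
                               (cappedDoubleᶜ n≤N X (toUnary n b)))
          (node⇓ ✓ (select⇓ false ✓ ✓))) , last
  body (tryᶜ L W U acc) =
    _ , if⇓ (any (X ─ (L ∪ W)))
          (call⇓ (zip⇓ {S = X} {U = L ∪ W} _ (zip-─ _ _) n≤N ✓ (zip⇓ {S = L} {U = W} _ refl n≤N ✓ ✓)) (anyᶜ n≤N _))
          (if⇓ (any (Y ∩ L)) (call⇓ (zip⇓ {S = Y} {U = L} _ refl n≤N ✓ ✓) (anyᶜ n≤N _))
            (if⇓ (member L U) (call⇓ ✓ (memberᶜ n≤N L U)) ✓
              (call⇓ (node⇓ (zip⇓ {S = L} {U = W} _ refl n≤N ✓ ✓) ✓) (insertᶜ n≤N (L ∪ W) acc)))
            ✓)
          ✓ , s≤s z≤n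
  body (processᶜ W U acc) =
    _ , if⇓ (any W) (call⇓ ✓ (anyᶜ n≤N W)) ✓
          (let⇓ (zip⇓ {S = W} _ (zip-∁ W) n≤N ✓ ✓)
          (let⇓ (call⇓ (node⇓ ✓ (node⇓ (call⇓ ✓ (firstᶜ n≤N (∁ W))) ✓)) (closureᶜ ⌜ X ⌝ˢ _ (∁ W) spineX≤N))
          (call⇓ (node⇓ ✓ (node⇓ ✓ (node⇓ ✓
              (call⇓ (node⇓ (zip⇓ {S = ∁ W} {U = component I W} _ (zip-─ _ _) n≤N ✓ ✓) ✓) (tryᶜ _ W U acc)))))
            (tryᶜ (component I W) W U _)))) , s≤s z≤n
  body (branchᶜ leaf β F S U A _ _ _) =
    _ , case-leaf⇓ ✓ (call⇓ ✓ (processᶜ S A _)) , ≤-trans (m^n>0 2 (spine β)) (m≤m+n _ 0)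
  body (branchᶜ (node _ φ) leaf F S U A acc φ≤N β≤B)
    with any (pick I S U ∩ F) in eq
  ... | true = _ , case-node⇓ ✓
      (let⇓ (call⇓ ✓ (processᶜ S A acc))
      (let⇓ (pick⇓ ✓ ✓ ✓)
      (case-node⇓ (≡⇓ (cong ⌜_⌝ᵇ eq)
                     (call⇓ (zip⇓ {S = pick I S U} {U = F} _ refl n≤N ✓ ✓) (anyᶜ n≤N _)))
        (self⇓ (node⇓ ✓ (node⇓ ✓ (node⇓ ✓ (node⇓ (zip⇓ {S = S} {U = pick I S U} _ refl n≤N ✓ ✓)
                 (node⇓ (zip⇓ {S = U} {U = pick I S U} _ (zip-─ _ _) n≤N ✓ ✓) ✓)))))
          refl (branchᶜ φ leaf F (S ∪ pick I S U) (U ─ pick I S U) A _ (<⇒≤ φ≤N) β≤B)))))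
    , ≤-refl
  ... | false = _ , case-node⇓ ✓
      (let⇓ (call⇓ ✓ (processᶜ S A acc))
      (let⇓ (pick⇓ ✓ ✓ ✓)
      (case-leaf⇓ (≡⇓ (cong ⌜_⌝ᵇ eq)
                     (call⇓ (zip⇓ {S = pick I S U} {U = F} _ refl n≤N ✓ ✓) (anyᶜ n≤N _)))
        (case-leaf⇓ ✓ ✓))))
    , s≤s z≤n
  body (branchᶜ (node _ φ) (node x β) F S U A acc φ≤N β≤B)
    with any (pick I S U ∩ F) in eq
  ... | true = _ , case-node⇓ ✓
      (let⇓ (call⇓ ✓ (processᶜ S A acc))
      (let⇓ (pick⇓ ✓ ✓ ✓)
      (case-node⇓ (≡⇓ (cong ⌜_⌝ᵇ eq)
                     (call⇓ (zip⇓ {S = pick I S U} {U = F} _ refl n≤N ✓ ✓) (anyᶜ n≤N _)))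
        (self⇓ (node⇓ ✓ (node⇓ ✓ (node⇓ ✓ (node⇓ (zip⇓ {S = S} {U = pick I S U} _ refl n≤N ✓ ✓)
                 (node⇓ (zip⇓ {S = U} {U = pick I S U} _ (zip-─ _ _) n≤N ✓ ✓) ✓)))))
          refl (branchᶜ φ (node x β) F (S ∪ pick I S U) (U ─ pick I S U) A _ (<⇒≤ φ≤N) β≤B)))))
    , m<n+m _ (m^n>0 2 (suc (spine β)))
  ... | false = _ , case-node⇓ ✓
      (let⇓ (call⇓ ✓ (processᶜ S A acc))
      (let⇓ (pick⇓ ✓ ✓ ✓)
      (case-leaf⇓ (≡⇓ (cong ⌜_⌝ᵇ eq)
                     (call⇓ (zip⇓ {S = pick I S U} {U = F} _ refl n≤N ✓ ✓) (anyᶜ n≤N _)))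
        (case-node⇓ ✓
        (self⇓ (node⇓ ✓ (node⇓ ✓ (node⇓ ✓ (node⇓ (zip⇓ {S = S} {U = pick I S U} _ refl n≤N ✓ ✓)
                 (node⇓ (zip⇓ {S = U} {U = pick I S U} _ (zip-─ _ _) n≤N ✓ ✓) (node⇓ ✓
          (self⇓ (node⇓ ✓ (node⇓ ✓ (node⇓ ✓ (node⇓ ✓
                 (node⇓ (zip⇓ {S = U} {U = pick I S U} _ (zip-─ _ _) n≤N ✓ ✓) ✓)))))
            refl (branchᶜ φ β F S (U ─ pick I S U) A _ (<⇒≤ φ≤N) (<⇒≤ β≤B)))))))))
          refl (branchᶜ φ β F (S ∪ pick I S U) (U ─ pick I S U) A _
            (<⇒≤ φ≤N) (<⇒≤ β≤B)))))))
    , branching (spine φ) (spine β)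
    where
    -- Both calls have one unit less of fuel and of budget. The lost unit of budget pays for the
    -- doubling, the lost unit of fuel makes the inequality strict.
    branching : ∀ f b → suc f * 2 ^ b + suc f * 2 ^ b < suc (suc f) * 2 ^ suc b
    branching f b = subst (_< suc (suc f) * 2 ^ suc b) (eq′ (suc f) (2 ^ b))
      (m<n+m _ (m^n>0 2 (suc b)))
      where
      eq′ : ∀ x y → x * (2 * y) ≡ x * y + x * y
      eq′ x y = trans (cong (λ z → x * (y + z)) (+-identityʳ y)) (*-distribˡ-+ x y y)
  body (startsᶜ leaf R β F A acc _ _) = _ , case-leaf⇓ ✓ ✓ , s≤s z≤n
  body (startsᶜ (node _ φ) R β F A acc φ≤N β≤B) =
    _ , case-node⇓ ✓
      (let⇓ (call⇓ ✓ (firstᶜ n≤N R))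
      (let⇓ (zip⇓ {S = R} {U = first R} _ (zip-─ _ _) n≤N ✓ ✓)
      (call⇓ (node⇓ ✓ (node⇓ ✓ (node⇓ ✓ (node⇓ ✓ (node⇓ ✓ (node⇓ ✓
          (self⇓ ✓ refl (startsᶜ φ (R ─ first R) β F A acc (<⇒≤ φ≤N) β≤B))))))))
        (branchᶜ ⌜ X ⌝ˢ β F (first R) (R ─ first R) A _ spineX≤N β≤B))))
    , ≤-refl
  body (modeᶜ F β A acc β≤B) =
    _ , call⇓ (node⇓ ✓ (node⇓
          (zip⇓ {S = F} {U = X ∪ Y} _ (zip-∪∁ F (X ∪ Y)) n≤N ✓ (zip⇓ {S = X} {U = Y} _ refl n≤N ✓ ✓)) ✓))
        (startsᶜ ⌜ X ⌝ˢ (F ∪ ∁ (X ∪ Y)) β F A acc spineX≤N β≤B)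
    , s≤s z≤n
  body (roundsᶜ leaf ρ β A _ _) = _ , case-leaf⇓ ✓ ✓ , s≤s z≤n
  body (roundsᶜ (node _ φ) ρ β A φ≤N β≤B) =
    _ , case-node⇓ ✓ (self⇓ (node⇓ ✓ (node⇓ ✓ (node⇓ ✓ (node⇓ ✓
        (call⇓ (node⇓ (zip⇓ {S = X} _ (zip-const false X) n≤N ✓ ✓) (node⇓ ✓ (node⇓ ✓
        (call⇓ (node⇓ ✓ (node⇓ ✓ (node⇓ ✓
        (call⇓ (node⇓ ✓ (node⇓ ✓ (node⇓ ✓
        (call⇓ (node⇓ (zip⇓ {S = X} {U = Y} _ refl n≤N ✓ ✓) ✓) (modeᶜ (X ∪ Y) β A _ β≤B)))))
          (modeᶜ Y β A _ β≤B)))))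
          (modeᶜ X β A _ β≤B)))))
          (modeᶜ ⊥ β A _ β≤B))))))
      refl (roundsᶜ φ (right ρ) β _ (<⇒≤ φ≤N) β≤B))
    , ≤-refl

-- Time bounds

-- Charging both alternatives of a `case` makes the bound independent of the data.
cost : ∀ {e} → (Fin p → ℕ) → Exp p e → ℕ
cost κ (var x)      = 1
cost κ leaf         = 1
cost κ (node a b)   = 1 + (cost κ a + cost κ b)
cost κ (let′ a b)   = 1 + (cost κ a + cost κ b)
cost κ (case a b c) = 1 + (cost κ a + (cost κ b + cost κ c))
cost κ (call f a)   = 1 + (cost κ a + κ f)

module _ (I : Instance) where

  maxμ : Fin p → ℕ
  maxμ #branch = suc (inputSize I) * 2 ^ maxBudget I
  maxμ #discount = suc (2 + inputSize I + inputSize I)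
  maxμ _    = suc (inputSize I)

  -- κ i bounds the time of the functions below i; the others get 0.
  κ : ℕ → Fin p → ℕ
  κ zero    g = 0
  κ (suc i) g = if toℕ g ≡ᵇ i then maxμ g * cost (κ i) (lookup bs g) else κ i g

  -- The cost of one activation without its recursive calls, since `κ (toℕ g)` assigns 0 to `g`
  -- itself.
  unitCost : Fin p → ℕ
  unitCost g = cost (κ (toℕ g)) (lookup bs g)

  κ-< : ∀ i g → toℕ g < i → κ i g ≡ maxμ g * unitCost g
  κ-< (suc i) g g<1+i with toℕ g ≡ᵇ i in eq
  ... | true  rewrite ≡ᵇ⇒≡ (toℕ g) i (subst T (sym eq) _) = refl
  ... | false = κ-< i g (≤∧≢⇒< (≤-pred g<1+i) λ g≡i → subst T eq (≡⇒≡ᵇ (toℕ g) i g≡i))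

  μ≤maxμ : ∀ {g μ v w} → Call I g μ v w → μ ≤ maxμ g
  μ≤maxμ (selectᶜ b t) = s≤s z≤n
  μ≤maxμ (zipᶜ m≤N f S U) = s≤s m≤N
  μ≤maxμ (anyᶜ m≤N S) = s≤s m≤N
  μ≤maxμ (firstᶜ m≤N S) = s≤s m≤N
  μ≤maxμ (neighboursᶜ m≤N rs S A) = s≤s m≤N
  μ≤maxμ (closureᶜ φ S D φ≤N) = s≤s φ≤N
  μ≤maxμ (memberᶜ m≤N S t) = s≤s m≤N
  μ≤maxμ (insertᶜ m≤N S t) = s≤s m≤N
  μ≤maxμ (discountᶜ m≤N S t) = s≤s m≤N
  μ≤maxμ (cappedDoubleᶜ c≤N S m) = s≤s c≤N
  μ≤maxμ (toUnaryᶜ b b≤N) = s≤s b≤N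
  μ≤maxμ (tryᶜ L W U acc) = s≤s z≤n
  μ≤maxμ (processᶜ W U acc) = s≤s z≤n
  μ≤maxμ (branchᶜ φ β F S U A acc φ≤N β≤B) = *-mono-≤ (s≤s φ≤N) (^-monoʳ-≤ 2 β≤B)
  μ≤maxμ (startsᶜ φ R β F A acc φ≤N β≤B) = s≤s φ≤N
  μ≤maxμ (modeᶜ F β A acc β≤B) = s≤s z≤n
  μ≤maxμ (roundsᶜ φ ρ β A φ≤N β≤B) = s≤s φ≤N

  Ev : ∀ {e} → Vec Tree e → Exp p e → Tree → ℕ → Set
  Ev ρ a v T = ∃ λ t → Eval bs ρ a v t × t ≤ T

  Returns : Fin p → Tree → Tree → ℕ → Set
  Returns g v w T = Ev (v ∷ []) (lookup bs g) w T

  Ev-≤ : ∀ {e} {ρ : Vec Tree e} {a v T U} → T ≤ U → Ev ρ a v T → Ev ρ a v U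
  Ev-≤ T≤U (t , ev , t≤T) = t , ev , ≤-trans t≤T T≤U

  sum-≤ : ∀ {s t x y q r} c → s ≤ x + q * c → t ≤ y + r * c →
          1 + s + t ≤ 1 + (x + y) + (q + r) * c
  sum-≤ {s} {t} {x} {y} {q} {r} c s≤ t≤ =
    s≤s (≤-trans (+-mono-≤ s≤ t≤) (≤-reflexive (rearrange x y q r c)))
    where
    rearrange : ∀ x y q r c → (x + q * c) + (y + r * c) ≡ (x + y) + (q + r) * c
    rearrange = solve-∀

  combine : ∀ {e e′ e″} {ρ : Vec Tree e} {ρ′ : Vec Tree e′} {ρ″ : Vec Tree e″} {a b d v w u x y} →
            ∀ q r c → (∀ {s t} → Eval bs ρ a v s → Eval bs ρ′ b w t → Eval bs ρ″ d u (1 + s + t)) →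
            Ev ρ a v (x + q * c) → Ev ρ′ b w (y + r * c) → Ev ρ″ d u (1 + (x + y) + (q + r) * c)
  combine q r c rule (_ , d₁ , t₁) (_ , d₂ , t₂) = _ , rule d₁ d₂ , sum-≤ {q = q} {r} c t₁ t₂

  module _ {i : ℕ} (c m : ℕ)
    (lower : ∀ {g μ v w} → toℕ g < i → Call I g μ v w → Returns g v w (μ * unitCost g))
    (self : ∀ {g μ v w} → toℕ g ≡ i → μ ≤ m → Call I g μ v w → Returns g v w (μ * c))
    where

    -- A recursive call of weight `μ` is charged `μ * c`, and the weights add up to `q`; all other
    -- calls are already included in `cost (κ i) a`.
    interpret : ∀ {e} {ρ : Vec Tree e} {a v q} → q ≤ m → Sem I i ρ a v q →
                Ev ρ a v (cost (κ i) a + q * c)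
    interpret q≤m var⇓ = 1 , var , ≤-refl
    interpret q≤m leaf⇓ = 1 , leaf , ≤-refl
    interpret q≤m (node⇓ {q = q} {r} d₁ d₂) =
      combine q r c node (interpret (m+n≤o⇒m≤o _ q≤m) d₁) (interpret (m+n≤o⇒n≤o q q≤m) d₂)
    interpret q≤m (let⇓ {q = q} {r} d₁ d₂) =
      combine q r c let′ (interpret (m+n≤o⇒m≤o _ q≤m) d₁) (interpret (m+n≤o⇒n≤o q q≤m) d₂)
    interpret q≤m (case-leaf⇓ {q = q} {r} d₁ d₂) =
      combine q r c case-leaf (interpret (m+n≤o⇒m≤o _ q≤m) d₁)
        (Ev-≤ (+-monoˡ-≤ (r * c) (m≤m+n _ _)) (interpret (m+n≤o⇒n≤o q q≤m) d₂))
    interpret q≤m (case-node⇓ {q = q} {r} d₁ d₂) =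
      combine q r c case-node (interpret (m+n≤o⇒m≤o _ q≤m) d₁)
        (Ev-≤ (+-monoˡ-≤ (r * c) (m≤n+m _ _)) (interpret (m+n≤o⇒n≤o q q≤m) d₂))
    interpret q≤m (call⇓ {g} {a} {v} {w} {q} {μ} {lt = lt} d f) =
      subst (λ z → Ev _ (call g a) w (cost (κ i) (call g a) + z * c)) (+-identityʳ q)
        (combine q 0 c call (interpret q≤m d)
          (Ev-≤ (≤-trans (*-monoˡ-≤ (unitCost g) (μ≤maxμ f))
                  (≤-reflexive (trans (sym (κ-< i g (<ᵇ⇒< _ _ lt))) (sym (+-identityʳ _)))))
                (lower (<ᵇ⇒< _ _ lt) f)))
    interpret q≤m (self⇓ {q = q} {μ} d g≡i f) =
      combine q μ c call (interpret (m+n≤o⇒m≤o _ q≤m) d)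
        (Ev-≤ (m≤n+m _ _) (self g≡i (m+n≤o⇒n≤o q q≤m) f))

  -- Lexicographic induction: calls to other functions lower `i`, recursive calls lower the weight.
  -- An activation costs one `unitCost g` and its recursive calls `q` of them, and `1 + q ≤ μ`.
  returns : ∀ i {g} → toℕ g < i → ∀ m {μ v w} → μ ≤ m → Call I g μ v w → Returns g v w (μ * unitCost g)
  returns (suc i) g<1+i zero μ≤0 f = contradiction (≤-trans (proj₂ (proj₂ (body I f))) μ≤0) λ ()
  returns (suc i) {g} g<1+i (suc m) μ≤1+m f =
    let q , d , q<μ = body I f in
    Ev-≤ (*-monoˡ-≤ (unitCost g) q<μ)
      (interpret (unitCost g) m
        (λ g′<g f′ → returns i (<-≤-trans g′<g (≤-pred g<1+i)) _ ≤-refl f′)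
        (λ {g′} {μ′} g′≡g μ′≤m f′ → cast μ′ (toℕ-injective g′≡g)
          (returns (suc i) (subst (_< suc i) (sym g′≡g) g<1+i) m μ′≤m f′))
        (≤-pred (≤-trans q<μ μ≤1+m)) d)
    where
    cast : ∀ {g′ v w} μ → g′ ≡ g → Returns g′ v w (μ * unitCost g′) → Returns g′ v w (μ * unitCost g)
    cast μ refl r = r

  evaluates : ∀ {e} {ρ : Vec Tree e} {a v} → Sem I p ρ a v 0 → Ev ρ a v (cost (κ p) a)
  evaluates d = Ev-≤ (≤-reflexive (+-identityʳ _))
    (interpret 0 0 (λ {g} _ f → returns p (toℕ<n g) _ ≤-refl f)
      (λ {g} g≡p → contradiction g≡p (<⇒≢ (toℕ<n g))) z≤n d)

-- O 0 consists of the polynomially bounded functions, O 1 is O*(2^exponent).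
record O (j : ℕ) (f : Instance → ℕ) : Set where
  constructor mkO
  field
    coefficient degree : ℕ
    bound : ∀ I → f I ≤ coefficient * inputSize I ^ degree * (2 ^ exponent I) ^ j

size-nonZero : ∀ t → NonZero (treeSize t)
size-nonZero leaf       = _
size-nonZero (node _ _) = _

O-weaken : ∀ {f i j} → i ≤ j → O i f → O j f
O-weaken i≤j (mkO c d f≤) = mkO c d λ I →
  ≤-trans (f≤ I) (*-monoʳ-≤ (c * _) (^-monoʳ-≤ (2 ^ exponent I) {{m^n≢0 2 (exponent I)}} i≤j))

O-const : ∀ {j} k → O j (λ _ → k)
O-const {j} k = mkO k 0 λ I →
  ≤-trans (≤-reflexive (sym (trans (*-identityʳ _) (*-identityʳ k))))
          (*-monoʳ-≤ (k * 1) (m^n>0 (2 ^ exponent I) {{m^n≢0 2 (exponent I)}} j))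

O-size : O 0 inputSize
O-size = mkO 1 1 λ I → ≤-reflexive (eq (inputSize I))
  where
  eq : ∀ s → s ≡ 1 * (s * 1) * 1
  eq = solve-∀

O-≤ : ∀ {j f g} → (∀ I → f I ≤ g I) → O j g → O j f
O-≤ f≤g (mkO c d g≤) = mkO c d λ I → ≤-trans (f≤g I) (g≤ I)

O-+ : ∀ {j f g} → O j f → O j g → O j (λ I → f I + g I)
O-+ {j} (mkO c d f≤) (mkO c′ d′ g≤) = mkO (c + c′) (d + d′) λ I →
  let s = inputSize I
      instance _ = size-nonZero (encode I)
      E = (2 ^ exponent I) ^ j
  in ≤-trans (+-mono-≤ (≤-trans (f≤ I) (*-monoˡ-≤ E (*-monoʳ-≤ c (^-monoʳ-≤ s (m≤m+n d d′)))))
                       (≤-trans (g≤ I) (*-monoˡ-≤ E (*-monoʳ-≤ c′ (^-monoʳ-≤ s (m≤n+m d′ d))))))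
             (≤-reflexive (eq c c′ (s ^ (d + d′)) E))
  where
  eq : ∀ c c′ x y → c * x * y + c′ * x * y ≡ (c + c′) * x * y
  eq = solve-∀

O-* : ∀ {i j f g} → O i f → O j g → O (i + j) (λ I → f I * g I)
O-* {i} {j} (mkO c d f≤) (mkO c′ d′ g≤) = mkO (c * c′) (d + d′) λ I →
  let s = inputSize I
      E = 2 ^ exponent I
  in ≤-trans (*-mono-≤ (f≤ I) (g≤ I)) (≤-reflexive
       (trans (eq c c′ (s ^ d) (s ^ d′) (E ^ i) (E ^ j))
         (sym (cong₂ (λ x y → c * c′ * x * y) (^-distribˡ-+-* s d d′) (^-distribˡ-+-* E i j)))))
  where
  eq : ∀ c c′ x x′ y y′ → c * x * y * (c′ * x′ * y′) ≡ c * c′ * (x * x′) * (y * y′)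
  eq = solve-∀

O-cost : ∀ {j} {k : Instance → Fin p → ℕ} → (∀ g → O j (λ I → k I g)) →
         ∀ {e} (a : Exp p e) → O j (λ I → cost (k I) a)
O-cost h (var x)      = O-const 1
O-cost h leaf         = O-const 1
O-cost h (node a b)   = O-+ (O-const 1) (O-+ (O-cost h a) (O-cost h b))
O-cost h (let′ a b)   = O-+ (O-const 1) (O-+ (O-cost h a) (O-cost h b))
O-cost h (case a b c) = O-+ (O-const 1) (O-+ (O-cost h a) (O-+ (O-cost h b) (O-cost h c)))
O-cost h (call f a)   = O-+ (O-const 1) (O-+ (O-cost h a) (h f))

-- 13 is the index of branch, the only function with an exponential number of calls.
δ : ℕ → ℕ
δ i = if i ≡ᵇ 13 then 1 else 0

degree : ℕ → ℕ
degree zero    = 0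
degree (suc i) = δ i + degree i

O-maxμ : ∀ g → O (δ (toℕ g)) (λ I → maxμ I g)
O-maxμ #branch = O-* {0} {1} O-1+size (O-≤ (λ I → ≤-reflexive (^-distribˡ-+-* 2 5 (exponent I)))
                -- 32 is 2 ^ 5, from the 5 in `maxBudget`.
                (O-* {0} {1} (O-const 32) (mkO 1 0 λ I → ≤-reflexive (eq (2 ^ exponent I)))))
  where
  O-1+size : O 0 (λ I → suc (inputSize I))
  O-1+size = O-+ (O-const 1) O-size
  eq : ∀ s → s ≡ 1 * 1 * (s * 1)
  eq = solve-∀
O-maxμ #discount = O-+ (O-const 1) (O-+ (O-+ (O-const 2) O-size) O-size)
O-maxμ #select = O-+ (O-const 1) O-size
O-maxμ #zip = O-+ (O-const 1) O-size
O-maxμ #any = O-+ (O-const 1) O-size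
O-maxμ #first = O-+ (O-const 1) O-size
O-maxμ #neighbours = O-+ (O-const 1) O-size
O-maxμ #closure = O-+ (O-const 1) O-size
O-maxμ #member = O-+ (O-const 1) O-size
O-maxμ #insert = O-+ (O-const 1) O-size
O-maxμ #cappedDouble = O-+ (O-const 1) O-size
O-maxμ #toUnary = O-+ (O-const 1) O-size
O-maxμ #try = O-+ (O-const 1) O-size
O-maxμ #process = O-+ (O-const 1) O-size
O-maxμ #starts = O-+ (O-const 1) O-size
O-maxμ #mode = O-+ (O-const 1) O-size
O-maxμ #rounds = O-+ (O-const 1) O-size

O-κ : ∀ i g → O (degree i) (λ I → κ I i g)
O-κ zero    g = O-const 0
O-κ (suc i) g with toℕ g ≡ᵇ i in eq
... | true  = O-* {f = λ I → maxμ I g}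
    (subst (λ k → O (δ k) (λ I → maxμ I g)) (≡ᵇ⇒≡ (toℕ g) i (subst T (sym eq) _)) (O-maxμ g))
                  (O-cost (O-κ i) (lookup bs g))
... | false = O-weaken (m≤n+m _ (δ i)) (O-κ i g)

-- `degree p` computes to 1: passing from one function to the next multiplies the bound by `maxμ`,
-- which is exponential for `branch` alone.
O-main : O 1 (λ I → cost (κ I p) main-body)
O-main = O-cost (O-κ p) main-body

-- The budget

spine-right : ∀ t → spine (right t) ≡ spine t ∸ 1
spine-right leaf       = refl
spine-right (node _ t) = refl

spine-discount : ∀ {m} (S : Subset m) t → spine (discount S t) ≡ spine t ∸ ∣ S ∣
spine-discount []          t = refl
spine-discount (false ∷ S) t = spine-discount S t
spine-discount (true ∷ S)  t = trans (spine-discount S (right t))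
  (trans (cong (_∸ ∣ S ∣) (spine-right t)) (∸-+-assoc (spine t) 1 ∣ S ∣))

cappedDouble≡ : ∀ c m → cappedDouble c m ≡ 2 * (c ⊓ m)
cappedDouble≡ zero    m       = refl
cappedDouble≡ (suc c) zero    = refl
cappedDouble≡ (suc c) (suc m) = trans (cong (2 +_) (cappedDouble≡ c m)) (sym (*-suc 2 (c ⊓ m)))

cappedDouble≤ˡ : ∀ c m → cappedDouble c m ≤ 2 * c
cappedDouble≤ˡ c m = ≤-trans (≤-reflexive (cappedDouble≡ c m)) (*-monoʳ-≤ 2 (m⊓n≤m c m))

cappedDouble≤ʳ : ∀ c m → cappedDouble c m ≤ 2 * m
cappedDouble≤ʳ c m = ≤-trans (≤-reflexive (cappedDouble≡ c m)) (*-monoʳ-≤ 2 (m⊓n≤n c m))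

toUnary≤toℕ : ∀ c b → toUnary c b ≤ ℕᵇ.toℕ b
toUnary≤toℕ c ℕᵇ.zero  = z≤n
toUnary≤toℕ c 2[1+ b ] = ≤-trans (+-monoʳ-≤ 2 (≤-trans (cappedDouble≤ʳ c _) (*-monoʳ-≤ 2 (toUnary≤toℕ c b))))
                              (≤-reflexive (sym (*-suc 2 (ℕᵇ.toℕ b))))
toUnary≤toℕ c 1+[2 b ] = s≤s (≤-trans (cappedDouble≤ʳ c _) (*-monoʳ-≤ 2 (toUnary≤toℕ c b)))

toUnary≤2c : ∀ c b → toUnary c b ≤ 2 + 2 * c
toUnary≤2c c ℕᵇ.zero  = z≤n
toUnary≤2c c 2[1+ b ] = +-monoʳ-≤ 2 (cappedDouble≤ˡ c _)
toUnary≤2c c 1+[2 b ] = s≤s (≤-trans (cappedDouble≤ˡ c _) (n≤1+n _))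

-- Capping before each doubling is harmless below `c`, as a value cut to `c` still doubles to at
-- least `c`. With `c` equal to `n` this suffices, because completeness uses the capped number only
-- as an upper bound of `n ⊓ k`.
⊓≤toUnary : ∀ c b → c ⊓ ℕᵇ.toℕ b ≤ toUnary c b
⊓≤toUnary c b = go b
  where
  double≥ : ∀ b → c ⊓ (2 * ℕᵇ.toℕ b) ≤ cappedDouble c (toUnary c b)
  go : ∀ b → c ⊓ ℕᵇ.toℕ b ≤ toUnary c b
  double≥ b = begin
    c ⊓ (2 * ℕᵇ.toℕ b)          ≤⟨ ⊓-monoˡ-≤ (2 * ℕᵇ.toℕ b) (m≤m+n c (c + 0)) ⟩
    (2 * c) ⊓ (2 * ℕᵇ.toℕ b)    ≡⟨ *-distribˡ-⊓ 2 c (ℕᵇ.toℕ b) ⟨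
    2 * (c ⊓ ℕᵇ.toℕ b)          ≤⟨ *-monoʳ-≤ 2 (⊓-glb (m⊓n≤m c (ℕᵇ.toℕ b)) (go b)) ⟩
    2 * (c ⊓ toUnary c b)          ≡⟨ cappedDouble≡ c (toUnary c b) ⟨
    cappedDouble c (toUnary c b)            ∎
    where open ≤-Reasoning
  go ℕᵇ.zero  = m⊓n≤n c 0
  go 2[1+ b ] = begin
    c ⊓ (2 * suc (ℕᵇ.toℕ b))    ≡⟨ cong (c ⊓_) (*-suc 2 (ℕᵇ.toℕ b)) ⟩
    c ⊓ (2 + 2 * ℕᵇ.toℕ b)      ≤⟨ ⊓-monoˡ-≤ (2 + 2 * ℕᵇ.toℕ b) (m≤n+m c 2) ⟩
    2 + c ⊓ (2 * ℕᵇ.toℕ b)      ≤⟨ +-monoʳ-≤ 2 (double≥ b) ⟩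
    2 + cappedDouble c (toUnary c b)        ∎
    where open ≤-Reasoning
  go 1+[2 b ] = begin
    c ⊓ (1 + 2 * ℕᵇ.toℕ b)      ≤⟨ ⊓-monoˡ-≤ (1 + 2 * ℕᵇ.toℕ b) (n≤1+n c) ⟩
    1 + c ⊓ (2 * ℕᵇ.toℕ b)      ≤⟨ s≤s (double≥ b) ⟩
    1 + cappedDouble c (toUnary c b)        ∎
    where open ≤-Reasoning

⌜tabulate⌝ : ∀ {m n} (f : Fin m → Fin n → Bool) →
  ⌜ tabulate (λ u → ⌜ tabulate (λ v → ⌜ f u v ⌝ᵇ) ⌝ᵛ) ⌝ᵛ ≡ ⌜ map ⌜_⌝ˢ (tabulate λ u → tabulate (f u)) ⌝ᵛ
⌜tabulate⌝ f = cong ⌜_⌝ᵛ (trans (tabulate-cong λ u → cong ⌜_⌝ᵛ (tabulate-∘ ⌜_⌝ᵇ (f u)))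
                                (tabulate-∘ ⌜_⌝ˢ λ u → tabulate (f u)))

module _ (I : Instance) where
  open Instance I

  k′ : ℕ
  k′ = toUnary n (ℕᵇ.fromℕ k)

  k′≤k : k′ ≤ k
  k′≤k = ≤-trans (toUnary≤toℕ n (ℕᵇ.fromℕ k)) (≤-reflexive (toℕᵇ-fromℕᵇ k))

  n⊓k≤k′ : n ⊓ k ≤ k′
  n⊓k≤k′ = subst (λ z → n ⊓ z ≤ k′) (toℕᵇ-fromℕᵇ k) (⊓≤toUnary n (ℕᵇ.fromℕ k))

  budget : Tree
  budget = discount Y (discount X (ones (5 + k′)))

  spine-budget : spine budget ≡ 5 + k′ ∸ (∣ X ∣ + ∣ Y ∣)
  spine-budget = begin
    spine budget                                  ≡⟨ spine-discount Y (discount X (ones (5 + k′))) ⟩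
    spine (discount X (ones (5 + k′))) ∸ ∣ Y ∣         ≡⟨ cong (_∸ ∣ Y ∣) (spine-discount X (ones (5 + k′))) ⟩
    spine (ones (5 + k′)) ∸ ∣ X ∣ ∸ ∣ Y ∣         ≡⟨ cong (λ z → z ∸ ∣ X ∣ ∸ ∣ Y ∣) (spine-⌜⌝ (⊤ {5 + k′})) ⟩
    5 + k′ ∸ ∣ X ∣ ∸ ∣ Y ∣                        ≡⟨ ∸-+-assoc (5 + k′) ∣ X ∣ ∣ Y ∣ ⟩
    5 + k′ ∸ (∣ X ∣ + ∣ Y ∣)                      ∎
    where open ≡-Reasoning

  budget≤B : spine budget ≤ maxBudget I
  budget≤B = begin
    spine budget               ≡⟨ spine-budget ⟩
    5 + k′ ∸ (∣ X ∣ + ∣ Y ∣)   ≤⟨ ∸-monoˡ-≤ (∣ X ∣ + ∣ Y ∣) (+-monoʳ-≤ 5 k′≤k) ⟩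
    5 + k ∸ (∣ X ∣ + ∣ Y ∣)    ≤⟨ m+n∸o≤m+[n∸o] 5 k (∣ X ∣ + ∣ Y ∣) ⟩
    5 + (k ∸ (∣ X ∣ + ∣ Y ∣))  ∎
    where
    open ≤-Reasoning
    m+n∸o≤m+[n∸o] : ∀ m n o → m + n ∸ o ≤ m + (n ∸ o)
    m+n∸o≤m+[n∸o] m n zero    = ≤-refl
    m+n∸o≤m+[n∸o] m zero (suc o) = m∸n≤m (m + 0) (suc o)
    m+n∸o≤m+[n∸o] m (suc n) (suc o) rewrite +-suc m n = m+n∸o≤m+[n∸o] m n o

  remaining : Tree
  remaining = discount (⊤ {k′}) ⌜ X ⌝ˢ

  answer : Bool
  answer = member (⊤ {n}) (rounds I ⌜ X ⌝ˢ remaining budget (insert (⊥ {n}) leaf))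

  size≤N : ℕᵇ.size (ℕᵇ.fromℕ k) ≤ inputSize I
  size≤N = ≤-trans (lemma (ℕᵇ.fromℕ k))
    (≤-trans (m≤n+m _ (suc (treeSize ⌜ Y ⌝ˢ)))
    (≤-trans (m≤n+m _ (suc (treeSize ⌜ X ⌝ˢ)))
             (m≤n+m _ (suc (treeSize ⌜ G ⌝ᴳ)))))
    where
    lemma : ∀ b → ℕᵇ.size b ≤ treeSize ⌜ b ⌝ⁿ
    lemma ℕᵇ.zero  = z≤n
    lemma 2[1+ b ] = s≤s (≤-trans (lemma b) (m≤n+m _ 3))
    lemma 1+[2 b ] = s≤s (≤-trans (lemma b) (m≤n+m _ 1))

  k′≤2+N+N : k′ ≤ 2 + inputSize I + inputSize I
  k′≤2+N+N = ≤-trans (toUnary≤2c n (ℕᵇ.fromℕ k)) (s≤s (s≤s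
    (+-mono-≤ (n≤N I) (≤-trans (≤-reflexive (+-identityʳ n)) (n≤N I)))))

  n≤2+N+N : n ≤ 2 + inputSize I + inputSize I
  n≤2+N+N = ≤-trans (n≤N I) (≤-trans (m≤n+m (inputSize I) 2) (m≤m+n (2 + inputSize I) (inputSize I)))

  main⇓ : Sem I p (encode I ∷ []) main-body ⌜ answer ⌝ᵇ 0
  main⇓ = let⇓ (call⇓ (node⇓ (✓ I) (✓ I)) (toUnaryᶜ (ℕᵇ.fromℕ k) size≤N))
    (call⇓ (node⇓ (zip⇓ I {S = X} _ (zip-const true X) (n≤N I) (✓ I) (✓ I))
      (call⇓ (node⇓ (✓ I)
             (node⇓ (call⇓ (node⇓ (✓ I) (✓ I)) (discountᶜ k′≤2+N+N (⊤ {k′}) ⌜ X ⌝ˢ))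
             (node⇓ (call⇓ (node⇓ (✓ I) (call⇓ (node⇓ (✓ I) (✓ I)) (discountᶜ n≤2+N+N X (ones (5 + k′)))))
                       (discountᶜ n≤2+N+N Y (discount X (ones (5 + k′)))))
             (node⇓ (node⇓ (≡⇓ I (⌜tabulate⌝ (Graph.adj G)) (✓ I)) (✓ I))
                    (call⇓ (node⇓ (zip⇓ I {S = X} _ (zip-const false X) (n≤N I) (✓ I) (✓ I)) (✓ I))
                       (insertᶜ (n≤N I) (⊥ {n}) leaf))))))
         (roundsᶜ ⌜ X ⌝ˢ remaining budget (insert (⊥ {n}) leaf) (spineX≤N I) budget≤B)))
      (memberᶜ (n≤N I) ⊤ _))

-- Correctness of the set operations

any-sound : ∀ {m} (S : Subset m) → any S ≡ true → Nonempty S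
any-sound (true ∷ S)  eq = zero , here
any-sound (false ∷ S) eq = let x , x∈S = any-sound S eq in suc x , there x∈S

any-complete : ∀ {m} {S : Subset m} → Nonempty S → any S ≡ true
any-complete (zero  , here)      = refl
any-complete {S = true ∷ S} (suc x , there x∈S) = refl
any-complete {S = false ∷ S} (suc x , there x∈S) = any-complete (x , x∈S)

any-empty : ∀ {m} (S : Subset m) → Empty S → any S ≡ false
any-empty S ¬ne with any S in eq
... | true  = contradiction (any-sound S eq) ¬ne
... | false = refl

any-false : ∀ {m} (S : Subset m) → any S ≡ false → Empty S
any-false S eq ne with () ← trans (sym eq) (any-complete ne)

first-⊥ : ∀ {m} → first (⊥ {m}) ≡ ⊥
first-⊥ {zero}  = refl
first-⊥ {suc m} = cong (false ∷_) first-⊥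

first-nonempty : ∀ {m} (S : Subset m) → Nonempty S → ∃ λ u → u ∈ S × first S ≡ ⁅ u ⁆
first-nonempty (true ∷ S)  _ = zero , here , refl
first-nonempty (false ∷ S) (suc x , there x∈S) =
  let u , u∈S , eq = first-nonempty S (x , x∈S) in suc u , there u∈S , cong (false ∷_) eq

first-cases : ∀ {m} (S : Subset m) → first S ≡ ⊥ ⊎ (∃ λ u → u ∈ S × first S ≡ ⁅ u ⁆)
first-cases S with nonempty? S
... | yes ne = inj₂ (first-nonempty S ne)
... | no ¬ne = inj₁ (trans (cong first (Empty-unique ¬ne)) first-⊥)

neighbours⁻ : ∀ {m n} (rs : Vec (Subset n) m) S A {v} → v ∈ neighbours rs S A →
      v ∈ A ⊎ (∃ λ u → u ∈ S × v ∈ lookup rs u)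
neighbours⁻ []       []          A v∈ = inj₁ v∈
neighbours⁻ (r ∷ rs) (false ∷ S) A v∈ =
  map₂ (λ (u , u∈S , v∈r) → suc u , there u∈S , v∈r) (neighbours⁻ rs S A v∈)
neighbours⁻ (r ∷ rs) (true ∷ S)  A v∈ with neighbours⁻ rs S (r ∪ A) v∈
... | inj₂ (u , u∈S , v∈r) = inj₂ (suc u , there u∈S , v∈r)
... | inj₁ v∈r∪A with x∈p∪q⁻ r A v∈r∪A
...   | inj₁ v∈r = inj₂ (zero , here , v∈r)
...   | inj₂ v∈A = inj₁ v∈A

neighbours-⊇ : ∀ {m n} (rs : Vec (Subset n) m) S A → A ⊆ neighbours rs S A
neighbours-⊇ []       []          A v∈A = v∈A
neighbours-⊇ (r ∷ rs) (false ∷ S) A v∈A = neighbours-⊇ rs S A v∈A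
neighbours-⊇ (r ∷ rs) (true ∷ S)  A v∈A = neighbours-⊇ rs S (r ∪ A) (q⊆p∪q r A v∈A)

neighbours-rows : ∀ {m n} (rs : Vec (Subset n) m) S A {u v} → u ∈ S → v ∈ lookup rs u → v ∈ neighbours rs S A
neighbours-rows (r ∷ rs) (true ∷ S)  A here        v∈r = neighbours-⊇ rs S (r ∪ A) (p⊆p∪q A v∈r)
neighbours-rows (r ∷ rs) (false ∷ S) A (there u∈S) v∈r = neighbours-rows rs S A u∈S v∈r
neighbours-rows (r ∷ rs) (true ∷ S)  A (there u∈S) v∈r = neighbours-rows rs S (r ∪ A) u∈S v∈r

member-leaf : ∀ {m} (S : Subset m) → member S leaf ≡ false
member-leaf []          = refl
member-leaf (false ∷ S) = member-leaf S
member-leaf (true ∷ S)  = member-leaf S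

member-insert : ∀ {m} (S : Subset m) t → member S (insert S t) ≡ true
member-insert []          t = refl
member-insert (false ∷ S) t = member-insert S (left t)
member-insert (true ∷ S)  t = member-insert S (right t)

insert-mono : ∀ {m} (S S′ : Subset m) t → member S t ≡ true → member S (insert S′ t) ≡ true
insert-mono []          []           t eq = refl
insert-mono (false ∷ S) (false ∷ S′) t eq = insert-mono S S′ (left t) eq
insert-mono (false ∷ S) (true ∷ S′)  t eq = eq
insert-mono (true ∷ S)  (false ∷ S′) t eq = eq
insert-mono (true ∷ S)  (true ∷ S′)  t eq = insert-mono S S′ (right t) eq

member-insert⁻ : ∀ {m} (S S′ : Subset m) t → member S (insert S′ t) ≡ true → S ≡ S′ ⊎ member S t ≡ true
member-insert⁻ []          []           t eq = inj₁ refl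
member-insert⁻ (false ∷ S) (false ∷ S′) t eq = map₁ (cong (false ∷_)) (member-insert⁻ S S′ (left t) eq)
member-insert⁻ (false ∷ S) (true ∷ S′)  t eq = inj₂ eq
member-insert⁻ (true ∷ S)  (false ∷ S′) t eq = inj₂ eq
member-insert⁻ (true ∷ S)  (true ∷ S′)  t eq = map₁ (cong (true ∷_)) (member-insert⁻ S S′ (right t) eq)

x∈p─q⇒x∉q : ∀ {m} (S U : Subset m) {x} → x ∈ S ─ U → x ∉ U
x∈p─q⇒x∉q (_ ∷ S) (true ∷ U)  (there x∈) (there x∈U) = x∈p─q⇒x∉q S U x∈ x∈U
x∈p─q⇒x∉q (_ ∷ S) (false ∷ U) (there x∈) (there x∈U) = x∈p─q⇒x∉q S U x∈ x∈U

∣p∪q∣≤∣p∣+∣q∣ : ∀ {m} (S U : Subset m) → ∣ S ∪ U ∣ ≤ ∣ S ∣ + ∣ U ∣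
∣p∪q∣≤∣p∣+∣q∣ []          []          = z≤n
∣p∪q∣≤∣p∣+∣q∣ (false ∷ S) (false ∷ U) = ∣p∪q∣≤∣p∣+∣q∣ S U
∣p∪q∣≤∣p∣+∣q∣ (false ∷ S) (true ∷ U)  = ≤-trans (s≤s (∣p∪q∣≤∣p∣+∣q∣ S U)) (≤-reflexive (sym (+-suc ∣ S ∣ ∣ U ∣)))
∣p∪q∣≤∣p∣+∣q∣ (true ∷ S)  (false ∷ U) = s≤s (∣p∪q∣≤∣p∣+∣q∣ S U)
∣p∪q∣≤∣p∣+∣q∣ (true ∷ S)  (true ∷ U)  = s≤s (≤-trans (∣p∪q∣≤∣p∣+∣q∣ S U) (+-monoʳ-≤ ∣ S ∣ (n≤1+n ∣ U ∣)))

∣p∪q∣≡∣p∣+∣q∣ : ∀ {m} (S U : Subset m) → (∀ {x} → x ∈ S → x ∉ U) → ∣ S ∪ U ∣ ≡ ∣ S ∣ + ∣ U ∣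
∣p∪q∣≡∣p∣+∣q∣ []          []          disj = refl
∣p∪q∣≡∣p∣+∣q∣ (false ∷ S) (false ∷ U) disj = ∣p∪q∣≡∣p∣+∣q∣ S U λ x∈S x∈U → disj (there x∈S) (there x∈U)
∣p∪q∣≡∣p∣+∣q∣ (false ∷ S) (true ∷ U)  disj =
  trans (cong suc (∣p∪q∣≡∣p∣+∣q∣ S U λ x∈S x∈U → disj (there x∈S) (there x∈U))) (sym (+-suc ∣ S ∣ ∣ U ∣))
∣p∪q∣≡∣p∣+∣q∣ (true ∷ S)  (false ∷ U) disj = cong suc (∣p∪q∣≡∣p∣+∣q∣ S U λ x∈S x∈U → disj (there x∈S) (there x∈U))
∣p∪q∣≡∣p∣+∣q∣ (true ∷ S)  (true ∷ U)  disj = contradiction here (disj here)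

crossing : ∀ {m} {R : Fin m → Fin m → Set} (S : Subset m) {x y} → Star R x y → x ∈ S → y ∉ S →
           ∃₂ λ a b → a ∈ S × b ∉ S × R a b
crossing S ε x∈S y∉S = contradiction x∈S y∉S
crossing S (_◅_ {j = z} xz zs) x∈S y∉S with z ∈? S
... | yes z∈S = crossing S zs z∈S y∉S
... | no  z∉S = _ , _ , x∈S , z∉S , xz

-- Connected sets and components

module _ (I : Instance) where

  open Instance I hiding (disjoint)
  open Graph G

  Conn : Subset n → Set
  Conn S = ∀ {u v} → u ∈ S → v ∈ S → Star (EdgeWithin S) u v

  Edge-sym : ∀ {u v} → Edge u v → Edge v u
  Edge-sym {u} {v} uv = trans (symmetric v u) uv

  Conn-⊥ : Conn ⊥
  Conn-⊥ u∈⊥ _ = contradiction u∈⊥ ∉⊥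

  Conn-⁅⁆ : ∀ u → Conn ⁅ u ⁆
  Conn-⁅⁆ u x∈ y∈ with refl ← x∈⁅y⁆⇒x≡y u x∈ with refl ← x∈⁅y⁆⇒x≡y u y∈ = ε

  reverse : ∀ {S u v} → Star (EdgeWithin S) u v → Star (EdgeWithin S) v u
  reverse = Star.reverse λ (u∈S , v∈S , uv) → v∈S , u∈S , Edge-sym uv

  Conn-∪⁅⁆ : ∀ {S w u} → Conn S → w ∈ S → u ∈ S ⊎ Edge w u → Conn (S ∪ ⁅ u ⁆)
  Conn-∪⁅⁆ {S} {w} {u} conn w∈S adj x∈ y∈ = toW x∈ ◅◅ reverse (toW y∈)
    where
    inS : ∀ {x} → x ∈ S → x ∈ S ∪ ⁅ u ⁆
    inS = p⊆p∪q ⁅ u ⁆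
    fromS : ∀ {x} → x ∈ S → Star (EdgeWithin (S ∪ ⁅ u ⁆)) x w
    fromS x∈S = Star.map (λ (a∈S , b∈S , ab) → inS a∈S , inS b∈S , ab) (conn x∈S w∈S)
    toW : ∀ {x} → x ∈ S ∪ ⁅ u ⁆ → Star (EdgeWithin (S ∪ ⁅ u ⁆)) x w
    toW x∈ with x∈p∪q⁻ S ⁅ u ⁆ x∈
    ... | inj₁ x∈S = fromS x∈S
    ... | inj₂ x∈u with refl ← x∈⁅y⁆⇒x≡y u x∈u =
      [ fromS , (λ wu → (x∈ , inS w∈S , Edge-sym wu) ◅ ε) ]′ adj

  ∈-rows⁺ : ∀ {u v} → Edge u v → v ∈ lookup (rows I) u
  ∈-rows⁺ {u} {v} uv = lookup⇒[]= v _ (trans (cong (λ r → lookup r v)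
    (lookup∘tabulate (λ u → tabulate (adj u)) u)) (trans (lookup∘tabulate (adj u) v) uv))

  ∈-rows⁻ : ∀ {u v} → v ∈ lookup (rows I) u → Edge u v
  ∈-rows⁻ {u} {v} v∈ = trans (sym (trans (cong (λ r → lookup r v)
    (lookup∘tabulate (λ u → tabulate (adj u)) u)) (lookup∘tabulate (adj u) v))) ([]=⇒lookup v∈)

  N[_] : Subset n → Subset n
  N[ S ] = neighbours (rows I) S S

  ∈N⁺ : ∀ {S u v} → u ∈ S → Edge u v → v ∈ N[ S ]
  ∈N⁺ u∈S uv = neighbours-rows (rows I) _ _ u∈S (∈-rows⁺ uv)

  ∈N⁻ : ∀ {S v} → v ∈ N[ S ] → v ∈ S ⊎ (∃ λ u → u ∈ S × Edge u v)
  ∈N⁻ v∈ = map₂ (λ (u , u∈S , v∈r) → u , u∈S , ∈-rows⁻ v∈r) (neighbours⁻ (rows I) _ _ v∈)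

  S⊆N : ∀ {S} → S ⊆ N[ S ]
  S⊆N = neighbours-⊇ (rows I) _ _

  closure-⊆ : ∀ φ {S C} → S ⊆ C → closure I φ S C ⊆ C
  closure-⊆ leaf       S⊆C = S⊆C
  closure-⊆ (node _ φ) S⊆C = closure-⊆ φ (p∩q⊆q _ _)

  closure-⊇ : ∀ φ {S C} → S ⊆ C → S ⊆ closure I φ S C
  closure-⊇ leaf       S⊆C x∈S = x∈S
  closure-⊇ (node _ φ) S⊆C x∈S = closure-⊇ φ (p∩q⊆q _ _) (x∈p∩q⁺ (S⊆N x∈S , S⊆C x∈S))

  closure-least : ∀ φ {S C P} → S ⊆ P → (∀ {u v} → u ∈ P → Edge u v → v ∈ C → v ∈ P) → closure I φ S C ⊆ P
  closure-least leaf       S⊆P closed = S⊆P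
  closure-least (node _ φ) {S} {C} {P} S⊆P closed = closure-least φ step⊆ closed
    where
    step⊆ : N[ S ] ∩ C ⊆ P
    step⊆ x∈ with x∈p∩q⁻ N[ S ] C x∈
    ... | x∈N , x∈C with ∈N⁻ x∈N
    ...   | inj₁ x∈S = S⊆P x∈S
    ...   | inj₂ (u , u∈S , ux) = closed (S⊆P u∈S) ux x∈C

  Closed : Subset n → Subset n → Set
  Closed C S = ∀ {u v} → u ∈ S → Edge u v → v ∈ C → v ∈ S

  -- A round that adds no vertex has reached a fixed point, so a run that never became stable has
  -- grown by at least its fuel.
  closure-progress : ∀ φ {S C} → S ⊆ C → Closed C (closure I φ S C) ⊎ ∣ S ∣ + spine φ ≤ ∣ closure I φ S C ∣
  closure-progress leaf S⊆C = inj₂ (≤-reflexive (+-identityʳ _))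
  closure-progress (node _ φ) {S} {C} S⊆C with (N[ S ] ∩ C) ⊆? S
  ... | yes ⊆S = inj₁ (subst (Closed C) (sym (⊆-antisym (closure-least φ ⊆S closed)
                   (⊆-trans S⊆ (closure-⊇ φ (p∩q⊆q _ _))))) closed)
    where
    S⊆ : S ⊆ N[ S ] ∩ C
    S⊆ x∈S = x∈p∩q⁺ (S⊆N x∈S , S⊆C x∈S)
    closed : Closed C S
    closed u∈S uv v∈C = ⊆S (x∈p∩q⁺ (∈N⁺ u∈S uv , v∈C))
  ... | no  ⊈S with closure-progress φ {N[ S ] ∩ C} {C} (p∩q⊆q _ _)
  ...   | inj₁ closed = inj₁ closed
  ...   | inj₂ le = inj₂ (≤-trans (≤-reflexive (+-suc ∣ S ∣ (spine φ)))
                      (≤-trans (+-monoˡ-≤ (spine φ) S<) le))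
    where
    S< : ∣ S ∣ < ∣ N[ S ] ∩ C ∣
    S< with nonempty? ((N[ S ] ∩ C) ─ S)
    ... | yes (x , x∈) = p⊂q⇒∣p∣<∣q∣ ((λ x∈S → x∈p∩q⁺ (S⊆N x∈S , S⊆C x∈S)) ,
                           x , p─q⊆p _ _ x∈ , x∈p─q⇒x∉q (N[ S ] ∩ C) S x∈)
    ... | no empty = contradiction (λ {x} x∈ → in-S x x∈) ⊈S
      where
      in-S : ∀ x → x ∈ N[ S ] ∩ C → x ∈ S
      in-S x x∈ with x ∈? S
      ... | yes x∈S = x∈S
      ... | no  x∉S = contradiction (x , x∈p∧x∉q⇒x∈p─q x∈ x∉S) empty

  seed-⊆ : (S : Subset n) → first S ⊆ S
  seed-⊆ S x∈ with first-cases S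
  ... | inj₁ eq = contradiction (subst (_ ∈_) eq x∈) ∉⊥
  ... | inj₂ (u , u∈S , eq) with refl ← x∈⁅y⁆⇒x≡y u (subst (_ ∈_) eq x∈) = u∈S

  component-⊆ : ∀ W → component I W ⊆ ∁ W
  component-⊆ W = closure-⊆ ⌜ X ⌝ˢ {first (∁ W)} {∁ W} (seed-⊆ (∁ W))

  component-closed : ∀ W → Closed (∁ W) (component I W)
  component-closed W {u} {v} with closure-progress ⌜ X ⌝ˢ {first (∁ W)} {∁ W} (seed-⊆ (∁ W))
  ... | inj₁ closed = closed
  -- The fuel is `n`, so gaining a vertex in every round means that all vertices were reached, and
  -- `⊤` is closed.
  ... | inj₂ full = λ _ _ _ → subst (v ∈_) (sym eq) ∈⊤
    where
    eq : component I W ≡ ⊤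
    eq = ∣p∣≡n⇒p≡⊤ (≤-antisym (∣p∣≤n (component I W))
           (≤-trans (≤-reflexive (sym (spine-⌜⌝ X))) (m+n≤o⇒n≤o ∣ first (∁ W) ∣ full)))

-- A record instead of the bare equation, in which `member V t` may unfold so that `V` and `t` could
-- no longer be inferred.
record _∈ᵗ_ {m} (V : Subset m) (t : Tree) : Set where
  constructor stored
  field
    ∈ᵗ⇒member : member V t ≡ true
open _∈ᵗ_ public

-- Soundness and monotonicity of a step

module _ (I : Instance) where

  open Instance I hiding (disjoint; connected)
  open Graph G

  -- W can follow the bags with union L on a path witness.  Bags far apart are kept apart
  -- because the edges leaving L end in W.
  record Next (L W : Subset n) : Set where
    field
      nonempty  : Nonempty W
      connected : Conn I W
      disjoint  : ∀ {v} → v ∈ L → v ∉ W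
      separated : ∀ {u v} → u ∈ L → Edge u v → v ∈ L ⊎ v ∈ W
      X⊆        : X ⊆ L ∪ W
      Y∩        : ∀ {v} → v ∈ Y → v ∉ L

  -- `Q` is abstract because the property to be preserved changes from round to round: it will be
  -- reachability together with the number of steps still due.
  module _ (Q : Subset n → Set) (A : Tree)
    (next : ∀ {L W} → Next L W → L ∈ᵗ A → Q (L ∪ W)) where

    AllQ : Tree → Set
    AllQ t = ∀ S → S ∈ᵗ t → Q S

    try-sound : ∀ {L W acc} → Nonempty W → Conn I W → (∀ {v} → v ∈ L → v ∉ W) →
                (∀ {u v} → u ∈ L → Edge u v → v ∈ L ⊎ v ∈ W) → AllQ acc → AllQ (try I L W A acc)
    try-sound {L} {W} {acc} ne conn disj sep h
      with any (X ─ (L ∪ W)) in eqX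
    ... | true = h
    ... | false with any (Y ∩ L) in eqY
    ...   | true = h
    ...   | false with member L A in eqL
    ...     | false = h
    ...     | true  = λ S (stored eq) →
              [ (λ S≡ → subst Q (sym S≡) (next valid (stored eqL))) , (λ eq → h S (stored eq)) ]′
                (member-insert⁻ S (L ∪ W) acc eq)
      where
      X⊆ : X ⊆ L ∪ W
      X⊆ {x} x∈X with x ∈? (L ∪ W)
      ... | yes x∈ = x∈
      ... | no  x∉ = contradiction (x , x∈p∧x∉q⇒x∈p─q x∈X x∉) (any-false _ eqX)
      valid : Next L W
      valid = record { nonempty = ne ; connected = conn ; disjoint = disj ; separated = sep ; X⊆ = X⊆
                     ; Y∩ = λ v∈Y v∈L → any-false _ eqY (_ , x∈p∩q⁺ (v∈Y , v∈L)) }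

    -- `C` is closed within `∁ W`, so no edge joins it to the rest of `∁ W`. Hence the edges leaving
    -- either side end in `W`, and either side can serve as `L`.
    process-sound : ∀ {W acc} → Conn I W → AllQ acc → AllQ (process I W A acc)
    process-sound {W} {acc} conn h with any W in eq
    ... | false = h
    ... | true  = try-sound ne conn (λ v∈C → x∈∁p⇒x∉p (component-⊆ I W v∈C)) sepC
                   (try-sound ne conn (λ v∈R → x∈∁p⇒x∉p (p─q⊆p (∁ W) C v∈R)) sepR h)
      where
      C = component I W
      ne = any-sound W eq
      sepC : ∀ {u v} → u ∈ C → Edge u v → v ∈ C ⊎ v ∈ W
      sepC {v = v} u∈C uv with v ∈? W
      ... | yes v∈W = inj₂ v∈W
      ... | no  v∉W = inj₁ (component-closed I W u∈C uv (x∉p⇒x∈∁p v∉W))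
      sepR : ∀ {u v} → u ∈ ∁ W ─ C → Edge u v → v ∈ ∁ W ─ C ⊎ v ∈ W
      sepR {v = v} u∈R uv with v ∈? W | v ∈? C
      ... | yes v∈W | _       = inj₂ v∈W
      ... | no  v∉W | no v∉C  = inj₁ (x∈p∧x∉q⇒x∈p─q (x∉p⇒x∈∁p v∉W) v∉C)
      ... | no  v∉W | yes v∈C = contradiction
        (component-closed I W v∈C (Edge-sym I uv) (p─q⊆p (∁ W) C u∈R)) (x∈p─q⇒x∉q (∁ W) C u∈R)

    Conn-first : (R : Subset n) → Conn I (first R)
    Conn-first R with first-cases R
    ... | inj₁ eq           = subst (Conn I) (sym eq) (Conn-⊥ I)
    ... | inj₂ (u , _ , eq) = subst (Conn I) (sym eq) (Conn-⁅⁆ I u)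

    Conn-pick : ∀ {S} U → Conn I S → Conn I (S ∪ pick I S U)
    Conn-pick {S} U conn with first-cases (N[_] I S ∩ U)
    ... | inj₁ eq = subst (Conn I) (sym (trans (cong (S ∪_) eq) (∪-identityʳ S))) conn
    ... | inj₂ (u , u∈ , eq) = subst (Conn I) (sym (cong (S ∪_) eq)) conn′
      where
      conn′ : Conn I (S ∪ ⁅ u ⁆)
      conn′ with ∈N⁻ I (proj₁ (x∈p∩q⁻ _ U u∈))
      ... | inj₁ u∈S            = Conn-∪⁅⁆ I conn u∈S (inj₁ u∈S)
      ... | inj₂ (w , w∈S , wu) = Conn-∪⁅⁆ I conn w∈S (inj₂ wu)

    branch-sound : ∀ φ β {F S U acc} → Conn I S → AllQ acc → AllQ (branch I φ β F S U A acc)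
    branch-sound leaf β conn h = process-sound conn h
    branch-sound (node _ φ) leaf {F} {S} {U} conn h with any (pick I S U ∩ F)
    ... | true  = branch-sound φ leaf (Conn-pick U conn) (process-sound conn h)
    ... | false = process-sound conn h
    branch-sound (node _ φ) (node x β) {F} {S} {U} conn h with any (pick I S U ∩ F)
    ... | true  = branch-sound φ (node x β) (Conn-pick U conn) (process-sound conn h)
    ... | false = branch-sound φ β (Conn-pick U conn) (branch-sound φ β conn (process-sound conn h))

    starts-sound : ∀ φ {R β F acc} → AllQ acc → AllQ (starts I φ R β F A acc)
    starts-sound leaf h = h
    starts-sound (node _ φ) {R} {β} h = branch-sound ⌜ X ⌝ˢ β (Conn-first R) (starts-sound φ h)

    step-sound : ∀ β {acc} → AllQ acc → AllQ (step I β A acc)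
    step-sound β h = starts-sound ⌜ X ⌝ˢ (starts-sound ⌜ X ⌝ˢ (starts-sound ⌜ X ⌝ˢ (starts-sound ⌜ X ⌝ˢ h)))

  try-mono : ∀ {V} L W A acc → V ∈ᵗ acc → V ∈ᵗ (try I L W A acc)
  try-mono {V} L W A acc h with any (X ─ (L ∪ W)) | any (Y ∩ L) | member L A
  ... | true  | _     | _     = h
  ... | false | true  | _     = h
  ... | false | false | false = h
  ... | false | false | true  = stored (insert-mono V (L ∪ W) acc (∈ᵗ⇒member h))

  process-mono : ∀ {V} W A acc → V ∈ᵗ acc → V ∈ᵗ (process I W A acc)
  process-mono W A acc h with any W
  ... | false = h
  ... | true  = try-mono _ W A _ (try-mono _ W A acc h)

  -- Families only grow, so what processing `S` contributes survives all the calls that follow. This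
  -- ends the search in `branch-hit` as soon as `S` is the bag.
  branch-keeps : ∀ {V} φ β F S U A acc → V ∈ᵗ (process I S A acc) → V ∈ᵗ (branch I φ β F S U A acc)
  branch-mono : ∀ {V} φ β F S U A acc → V ∈ᵗ acc → V ∈ᵗ (branch I φ β F S U A acc)
  branch-mono φ β F S U A acc h = branch-keeps φ β F S U A acc (process-mono S A acc h)
  branch-keeps leaf β F S U A acc h = h
  branch-keeps (node _ φ) leaf F S U A acc h with any (pick I S U ∩ F)
  ... | true  = branch-keeps φ leaf F _ _ A _ (process-mono (S ∪ pick I S U) A _ h)
  ... | false = h
  branch-keeps (node _ φ) (node x β) F S U A acc h with any (pick I S U ∩ F)
  ... | true  = branch-keeps φ (node x β) F _ _ A _ (process-mono (S ∪ pick I S U) A _ h)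
  ... | false = branch-keeps φ β F _ _ A _ (process-mono (S ∪ pick I S U) A _
                    (branch-keeps φ β F S _ A _ (process-mono S A _ h)))

  starts-mono : ∀ {V} φ R β F A acc → V ∈ᵗ acc → V ∈ᵗ (starts I φ R β F A acc)
  starts-mono leaf R β F A acc h = h
  starts-mono (node _ φ) R β F A acc h = branch-mono ⌜ X ⌝ˢ β F _ _ A _ (starts-mono φ _ β F A acc h)

  mode-mono : ∀ {V} F β A acc → V ∈ᵗ acc → V ∈ᵗ (mode I F β A acc)
  mode-mono F β = starts-mono ⌜ X ⌝ˢ _ β F

  step-mono : ∀ {V} β A acc → V ∈ᵗ acc → V ∈ᵗ (step I β A acc)
  step-mono β A acc h =
    mode-mono ⊥ β A _ (mode-mono X β A _ (mode-mono Y β A _ (mode-mono (X ∪ Y) β A acc h)))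

-- Completeness of a step

module _ (I : Instance) where

  open Instance I hiding (disjoint; connected)
  open Graph G

  -- Connectedness of both sides of W determines L up to exchanging the two sides.
  record Splits (L W : Subset n) : Set where
    field
      next   : Next I L W
      left-connected  : Conn I L
      right-connected : Conn I (∁ (L ∪ W))
    open Next next public

  try-hit : ∀ {L W A acc} → Next I L W → L ∈ᵗ A → (L ∪ W) ∈ᵗ try I L W A acc
  try-hit {L} {W} {A} {acc} nx (stored eq)
    rewrite any-empty (X ─ (L ∪ W)) (λ (x , x∈) → x∈p─q⇒x∉q X (L ∪ W) x∈ (Next.X⊆ nx (p─q⊆p X _ x∈)))
          | any-empty (Y ∩ L) (λ (x , x∈) → let x∈Y , x∈L = x∈p∩q⁻ Y L x∈ in Next.Y∩ nx x∈Y x∈L)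
          | eq = stored (member-insert (L ∪ W) acc)

  -- Closedness of `P` keeps the closure inside `P`; conversely, walks in `P` from the seed never
  -- leave the closure.
  component-unique : ∀ {W P} → Nonempty (∁ W) → first (∁ W) ⊆ P → P ⊆ ∁ W → Closed I (∁ W) P → Conn I P →
                     component I W ≡ P
  component-unique {W} {P} ne seed⊆ P⊆ closed conn =
    ⊆-antisym (closure-least I ⌜ X ⌝ˢ seed⊆ closed) λ x∈P → walk (conn (seed⊆ s∈seed) x∈P) s∈C
    where
    s = proj₁ (first-nonempty (∁ W) ne)
    s∈seed : s ∈ first (∁ W)
    s∈seed = subst (s ∈_) (sym (proj₂ (proj₂ (first-nonempty (∁ W) ne)))) (x∈⁅x⁆ s)
    s∈C : s ∈ component I W
    s∈C = closure-⊇ I ⌜ X ⌝ˢ (seed-⊆ I (∁ W)) s∈seed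
    walk : ∀ {x y} → Star (EdgeWithin P) x y → x ∈ component I W → y ∈ component I W
    walk ε x∈ = x∈
    walk ((_ , z∈P , xz) ◅ zs) x∈ = walk zs (component-closed I W x∈ xz (P⊆ z∈P))

  -- `L` and `∁ (L ∪ W)` are connected with no edge between them, so the component is the one that
  -- contains the first vertex of `∁ W`.
  component-splits : ∀ {L W} → Splits L W → component I W ≡ L ⊎ ∁ W ─ component I W ≡ L
  component-splits {L} {W} sp with nonempty? (∁ W)
  ... | no empty = inj₁ (⊆-antisym
        (λ x∈C → contradiction (_ , component-⊆ I W x∈C) empty)
        (λ x∈L → contradiction (_ , x∉p⇒x∈∁p (disjoint x∈L)) empty))
    where open Splits sp
  ... | yes ne with first-nonempty (∁ W) ne
  ...   | s , s∈∁W , eq with s ∈? L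
  ...     | yes s∈L = inj₁ (component-unique ne seed⊆ (λ x∈L → x∉p⇒x∈∁p (disjoint x∈L)) closed left-connected)
    where
    open Splits sp
    seed⊆ : first (∁ W) ⊆ L
    seed⊆ x∈ with refl ← x∈⁅y⁆⇒x≡y s (subst (_ ∈_) eq x∈) = s∈L
    closed : Closed I (∁ W) L
    closed u∈L uv v∈∁W = [ id , (λ v∈W → contradiction v∈W (x∈∁p⇒x∉p v∈∁W)) ]′ (separated u∈L uv)
  ...     | no s∉L = inj₂ (⊆-antisym rest⊆ ⊆rest)
    where
    open Splits sp
    R = ∁ (L ∪ W)
    R⁺ : ∀ {x} → x ∉ L → x ∉ W → x ∈ R
    R⁺ x∉L x∉W = x∉p⇒x∈∁p λ x∈ → [ x∉L , x∉W ]′ (x∈p∪q⁻ L W x∈)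
    R∌L : ∀ {x} → x ∈ R → x ∉ L
    R∌L x∈R x∈L = x∈∁p⇒x∉p x∈R (p⊆p∪q W x∈L)
    R∌W : ∀ {x} → x ∈ R → x ∉ W
    R∌W x∈R x∈W = x∈∁p⇒x∉p x∈R (q⊆p∪q L W x∈W)
    seed⊆ : first (∁ W) ⊆ R
    seed⊆ x∈ with refl ← x∈⁅y⁆⇒x≡y s (subst (_ ∈_) eq x∈) = R⁺ s∉L (x∈∁p⇒x∉p s∈∁W)
    closed : Closed I (∁ W) R
    closed u∈R uv v∈∁W = R⁺ (λ v∈L → [ R∌L u∈R , R∌W u∈R ]′ (separated v∈L (Edge-sym I uv))) (x∈∁p⇒x∉p v∈∁W)
    C≡R : component I W ≡ R
    C≡R = component-unique ne seed⊆ (λ x∈R → x∉p⇒x∈∁p (R∌W x∈R)) closed right-connected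
    rest⊆ : ∁ W ─ component I W ⊆ L
    rest⊆ {x} x∈ with x ∈? L
    ... | yes x∈L = x∈L
    ... | no  x∉L = contradiction (subst (x ∈_) (sym C≡R) (R⁺ x∉L (x∈∁p⇒x∉p (p─q⊆p (∁ W) _ x∈))))
                                  (x∈p─q⇒x∉q (∁ W) _ x∈)
    ⊆rest : L ⊆ ∁ W ─ component I W
    ⊆rest {x} x∈L = x∈p∧x∉q⇒x∈p─q (x∉p⇒x∈∁p (disjoint x∈L)) λ x∈C → R∌L (subst (x ∈_) C≡R x∈C) x∈L

  process-hit : ∀ {L W A acc} → Splits L W → L ∈ᵗ A → (L ∪ W) ∈ᵗ process I W A acc
  process-hit {L} {W} {A} {acc} sp L∈A with any W | any-complete (Splits.nonempty sp)
  ... | .true | refl with component-splits sp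
  ...   | inj₁ eq = subst (λ C → (L ∪ W) ∈ᵗ try I C W A (try I (∁ W ─ component I W) W A acc)) (sym eq)
                      (try-hit (Splits.next sp) L∈A)
  ...   | inj₂ eq = try-mono I (component I W) W A _
                      (subst (λ C → (L ∪ W) ∈ᵗ try I C W A acc) (sym eq) (try-hit (Splits.next sp) L∈A))

  module _ {L W F R D : Subset n} {A : Tree} (sp : Splits L W) (L∈A : L ∈ᵗ A) (F⊆W : F ⊆ W)
    (costly : ∀ {u} → u ∈ R → u ∉ F → u ∈ W ⊎ (∃ λ w → w ∈ W × Edge w u) → u ∈ D) where

    open Splits sp

    -- Follows the run in which every pick is decided as `W` dictates. Two potentials control it:
    -- each pick lowers the size of `U`, paid from the fuel, and each unforced pick also lowers the
    -- size of `D ∩ U`, paid from the budget.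
    branch-hit : ∀ φ β {S U acc} → Nonempty S → S ⊆ W → W ⊆ S ∪ U → U ⊆ R →
              ∣ D ∩ U ∣ ≤ spine β → ∣ U ∣ ≤ spine φ → (L ∪ W) ∈ᵗ branch I φ β F S U A acc
    branch-hit φ β {S} {U} {acc} (s , s∈S) S⊆W W⊆ U⊆R D≤ U≤ with nonempty? (W ─ S)
    ... | no empty = branch-keeps I φ β F S U A acc
                       (subst (λ V → (L ∪ W) ∈ᵗ process I V A acc) W≡S (process-hit sp L∈A))
      where
      W≡S : W ≡ S
      W≡S = ⊆-antisym W⊆S S⊆W
        where
        W⊆S : W ⊆ S
        W⊆S {x} x∈W with x ∈? S
        ... | yes x∈S = x∈S
        ... | no  x∉S = contradiction (x , x∈p∧x∉q⇒x∈p─q x∈W x∉S) empty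
    ... | yes (x , x∈) = go φ β D≤ U≤
      where
      -- `W` is connected and not yet exhausted, so some edge inside `W` leaves `S`, and its end is
      -- still undecided.
      boundary : Nonempty (N[_] I S ∩ U)
      boundary with a , b , a∈S , b∉S , (_ , b∈W , ab) ←
        crossing S (connected (S⊆W s∈S) (p─q⊆p W S x∈)) s∈S (x∈p─q⇒x∉q W S x∈)
        with x∈p∪q⁻ S U (W⊆ b∈W)
      ... | inj₁ b∈S = contradiction b∈S b∉S
      ... | inj₂ b∈U = b , x∈p∩q⁺ (∈N⁺ I a∈S ab , b∈U)
      u = proj₁ (first-nonempty _ boundary)
      u∈ : u ∈ N[_] I S × u ∈ U
      u∈ = x∈p∩q⁻ _ U (proj₁ (proj₂ (first-nonempty _ boundary)))
      pick≡ : pick I S U ≡ ⁅ u ⁆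
      pick≡ = proj₂ (proj₂ (first-nonempty _ boundary))
      near : u ∈ W ⊎ (∃ λ w → w ∈ W × Edge w u)
      near = [ inj₁ ∘ S⊆W , (λ (w , w∈S , wu) → inj₂ (w , S⊆W w∈S , wu)) ]′ (∈N⁻ I (proj₁ u∈))
      U′ = U ─ pick I S U
      U′⊆U : U′ ⊆ U
      U′⊆U = p─q⊆p U _
      u∉U′ : u ∉ U′
      u∉U′ u∈U′ = x∈p─q⇒x∉q U _ u∈U′ (subst (u ∈_) (sym pick≡) (x∈⁅x⁆ u))
      U′⁺ : ∀ {y} → y ∈ U → y ≢ u → y ∈ U′
      U′⁺ y∈U y≢u = x∈p∧x∉q⇒x∈p─q y∈U λ y∈ → y≢u (x∈⁅y⁆⇒x≡y u (subst (_ ∈_) pick≡ y∈))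
      U′< : ∣ U′ ∣ < ∣ U ∣
      U′< = p⊂q⇒∣p∣<∣q∣ (U′⊆U , u , proj₂ u∈ , u∉U′)
      DU′⊆ : D ∩ U′ ⊆ D ∩ U
      DU′⊆ y∈ = let y∈D , y∈U′ = x∈p∩q⁻ D U′ y∈ in x∈p∩q⁺ (y∈D , U′⊆U y∈U′)
      DU′≤ : ∣ D ∩ U′ ∣ ≤ ∣ D ∩ U ∣
      DU′≤ = p⊆q⇒∣p∣≤∣q∣ DU′⊆
      u∈D : u ∉ F → u ∈ D
      u∈D u∉F = costly (U⊆R (proj₂ u∈)) u∉F near
      DU′< : u ∉ F → ∣ D ∩ U′ ∣ < ∣ D ∩ U ∣
      DU′< u∉F = p⊂q⇒∣p∣<∣q∣ (DU′⊆ , u , x∈p∩q⁺ (u∈D u∉F , proj₂ u∈) , λ u∈ → u∉U′ (proj₂ (x∈p∩q⁻ D U′ u∈)))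
      S′⊆W : u ∈ W → S ∪ pick I S U ⊆ W
      S′⊆W u∈W y∈ with x∈p∪q⁻ S _ y∈
      ... | inj₁ y∈S = S⊆W y∈S
      ... | inj₂ y∈u with refl ← x∈⁅y⁆⇒x≡y u (subst (_ ∈_) pick≡ y∈u) = u∈W
      W⊆′ : W ⊆ (S ∪ pick I S U) ∪ U′
      W⊆′ y∈W with x∈p∪q⁻ S U (W⊆ y∈W)
      ... | inj₁ y∈S = p⊆p∪q U′ (p⊆p∪q _ y∈S)
      ... | inj₂ y∈U with _ ∈? pick I S U
      ...   | yes y∈u = p⊆p∪q U′ (q⊆p∪q S _ y∈u)
      ...   | no  y∉u = q⊆p∪q _ U′ (x∈p∧x∉q⇒x∈p─q y∈U y∉u)
      W⊆″ : u ∉ W → W ⊆ S ∪ U′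
      W⊆″ u∉W {y} y∈W with x∈p∪q⁻ S U (W⊆ y∈W)
      ... | inj₁ y∈S = p⊆p∪q U′ y∈S
      ... | inj₂ y∈U = q⊆p∪q S U′ (U′⁺ y∈U λ { refl → u∉W y∈W })
      S′-nonempty : Nonempty (S ∪ pick I S U)
      S′-nonempty = s , p⊆p∪q _ s∈S
      forced : any (pick I S U ∩ F) ≡ true → u ∈ W
      forced eq with y , y∈ ← any-sound _ eq with y∈u , y∈F ← x∈p∩q⁻ (pick I S U) F y∈
        with refl ← x∈⁅y⁆⇒x≡y u (subst (_ ∈_) pick≡ y∈u) = F⊆W y∈F
      unforced : any (pick I S U ∩ F) ≡ false → u ∉ F
      unforced eq u∈F = any-false _ eq (u , x∈p∩q⁺ (subst (u ∈_) (sym pick≡) (x∈⁅x⁆ u) , u∈F))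

      go : ∀ φ β → ∣ D ∩ U ∣ ≤ spine β → ∣ U ∣ ≤ spine φ → (L ∪ W) ∈ᵗ branch I φ β F S U A acc
      go leaf β D≤ U≤ = contradiction (≤-trans (≤-<-trans z≤n U′<) U≤) λ ()
      go (node _ φ) leaf D≤ U≤ with any (pick I S U ∩ F) in eq
      ... | true  = branch-hit φ leaf S′-nonempty (S′⊆W (forced eq)) W⊆′ (U⊆R ∘ U′⊆U)
                      (≤-trans DU′≤ D≤) (≤-pred (≤-trans U′< U≤))
      -- An unforced `u` lies in `D ∩ U`, so the budget cannot be exhausted yet.
      ... | false = contradiction (≤-trans (≤-<-trans z≤n (DU′< (unforced eq))) D≤) λ ()
      go (node _ φ) (node y β) D≤ U≤ with any (pick I S U ∩ F) in eq
      ... | true  = branch-hit φ (node y β) S′-nonempty (S′⊆W (forced eq)) W⊆′ (U⊆R ∘ U′⊆U)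
                      (≤-trans DU′≤ D≤) (≤-pred (≤-trans U′< U≤))
      ... | false with u ∈? W
      ...   | yes u∈W = branch-hit φ β S′-nonempty (S′⊆W u∈W) W⊆′ (U⊆R ∘ U′⊆U)
                          (≤-pred (≤-trans (DU′< (unforced eq)) D≤)) (≤-pred (≤-trans U′< U≤))
      -- The call without `u` is evaluated first and is the accumulator of the call with `u`, which
      -- must preserve the hit.
      ...   | no  u∉W = branch-mono I φ β F _ _ A _
                          (branch-hit φ β (s , s∈S) S⊆W (W⊆″ u∉W) (U⊆R ∘ U′⊆U)
                            (≤-pred (≤-trans (DU′< (unforced eq)) D≤)) (≤-pred (≤-trans U′< U≤)))

    -- Starts outside `W` can be discarded, so all of `W` is still available when the first start
    -- inside `W` comes up.
    starts-hit : ∀ φ {β Q acc} → W ⊆ Q → Q ⊆ R → ∣ D ∣ ≤ spine β → ∣ Q ∣ ≤ spine φ →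
                 (L ∪ W) ∈ᵗ starts I φ Q β F A acc
    starts-hit φ {β} {Q} {acc} W⊆Q Q⊆R D≤ Q≤ = go φ Q≤
      where
      ne : Nonempty Q
      ne = _ , W⊆Q (proj₂ nonempty)
      u = proj₁ (first-nonempty Q ne)
      first≡ : first Q ≡ ⁅ u ⁆
      first≡ = proj₂ (proj₂ (first-nonempty Q ne))
      u∈Q : u ∈ Q
      u∈Q = proj₁ (proj₂ (first-nonempty Q ne))
      u∈first : u ∈ first Q
      u∈first = subst (u ∈_) (sym first≡) (x∈⁅x⁆ u)
      Q′ = Q ─ first Q
      Q′< : ∣ Q′ ∣ < ∣ Q ∣
      Q′< = p⊂q⇒∣p∣<∣q∣ (p─q⊆p Q _ , u , u∈Q , λ u∈ → x∈p─q⇒x∉q Q _ u∈ u∈first)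
      go : ∀ φ → ∣ Q ∣ ≤ spine φ → (L ∪ W) ∈ᵗ starts I φ Q β F A acc
      go leaf Q≤ = contradiction (≤-trans (≤-<-trans z≤n Q′<) Q≤) λ ()
      go (node _ φ) Q≤ with u ∈? W
      ... | yes u∈W = branch-hit ⌜ X ⌝ˢ β (u , u∈first) first⊆W W⊆ (Q⊆R ∘ p─q⊆p Q _)
                        (≤-trans (∣p∩q∣≤∣p∣ D Q′) D≤)
                        (≤-trans (∣p∣≤n Q′) (≤-reflexive (sym (spine-⌜⌝ X))))
        where
        first⊆W : first Q ⊆ W
        first⊆W y∈ with refl ← x∈⁅y⁆⇒x≡y u (subst (_ ∈_) first≡ y∈) = u∈W
        W⊆ : W ⊆ first Q ∪ Q′
        W⊆ {y} y∈W with y ∈? first Q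
        ... | yes y∈ = p⊆p∪q Q′ y∈
        ... | no  y∉ = q⊆p∪q (first Q) Q′ (x∈p∧x∉q⇒x∈p─q (W⊆Q y∈W) y∉)
      ... | no u∉W = branch-mono I ⌜ X ⌝ˢ β F _ _ A _
                       (starts-hit φ W⊆Q′ (Q⊆R ∘ p─q⊆p Q _) D≤ (≤-pred (≤-trans Q′< Q≤)))
        where
        W⊆Q′ : W ⊆ Q′
        W⊆Q′ y∈W = x∈p∧x∉q⇒x∈p─q (W⊆Q y∈W) λ y∈ →
          u∉W (subst (_∈ W) (x∈⁅y⁆⇒x≡y u (subst (_ ∈_) first≡ y∈)) y∈W)

∣m-n∣≡1 : ∀ m n → ∣ m - n ∣ ≡ 1 → n ≡ suc m ⊎ m ≡ suc n
∣m-n∣≡1 zero    n       eq = inj₁ eq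
∣m-n∣≡1 (suc m) zero    eq = inj₂ eq
∣m-n∣≡1 (suc m) (suc n) eq with ∣m-n∣≡1 m n eq
... | inj₁ refl = inj₁ refl
... | inj₂ refl = inj₂ refl

module _ (I : Instance) where

  open Instance I
  open Graph G

  -- What makes a bag discoverable with budget `β`. The last two fields say that `W` cuts neither
  -- `X` nor `Y`, so that one of the four modes guesses right.
  record Affordable (β : Tree) (W : Subset n) : Set where
    field
      costly   : Subset n
      size     : ∣ costly ∣ ≤ spine β
      costly⁺  : ∀ {u} → u ∉ X ∪ Y → u ∈ W ⊎ (∃ λ w → w ∈ W × Edge w u) → u ∈ costly
      X-uncut  : X ⊆ W ⊎ (∀ {x} → x ∈ W → x ∉ X)
      Y-uncut  : Y ⊆ W ⊎ (∀ {x} → x ∈ W → x ∉ Y)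

  module _ {β : Tree} {L W : Subset n} {A : Tree} (sp : Splits I L W) (aff : Affordable β W)
    (L∈A : L ∈ᵗ A) where

    open Affordable aff

    mode-hit : ∀ {F acc} → F ⊆ W → (∀ {x} → x ∈ W → x ∈ X ∪ Y → x ∈ F) → (L ∪ W) ∈ᵗ mode I F β A acc
    mode-hit {F} F⊆W W∩⊆F =
      starts-hit I sp L∈A F⊆W
        (λ {u} u∈R u∉F → costly⁺ ([ (λ u∈F → contradiction u∈F u∉F) , x∈∁p⇒x∉p ]′ (x∈p∪q⁻ F _ u∈R)))
        ⌜ X ⌝ˢ W⊆R id size (≤-trans (∣p∣≤n (F ∪ ∁ (X ∪ Y))) (≤-reflexive (sym (spine-⌜⌝ X))))
      where
      W⊆R : W ⊆ F ∪ ∁ (X ∪ Y)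
      W⊆R {x} x∈W with x ∈? (X ∪ Y)
      ... | yes x∈ = p⊆p∪q _ (W∩⊆F x∈W x∈)
      ... | no  x∉ = q⊆p∪q F _ (x∉p⇒x∈∁p x∉)

    step-hit : ∀ {acc} → (L ∪ W) ∈ᵗ step I β A acc
    -- The modes are nested with `⊥` outermost, so a hit in an inner mode has to survive the outer
    -- ones.
    step-hit with X-uncut | Y-uncut
    ... | inj₁ X⊆W | inj₁ Y⊆W =
      mode-mono I ⊥ β A _ (mode-mono I X β A _ (mode-mono I Y β A _
        (mode-hit (λ x∈ → [ X⊆W , Y⊆W ]′ (x∈p∪q⁻ X Y x∈)) λ _ x∈ → x∈)))
    ... | inj₁ X⊆W | inj₂ W∌Y =
      mode-mono I ⊥ β A _
        (mode-hit X⊆W λ x∈W x∈ → [ id , (λ x∈Y → contradiction x∈Y (W∌Y x∈W)) ]′ (x∈p∪q⁻ X Y x∈))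
    ... | inj₂ W∌X | inj₁ Y⊆W =
      mode-mono I ⊥ β A _ (mode-mono I X β A _
        (mode-hit Y⊆W λ x∈W x∈ → [ (λ x∈X → contradiction x∈X (W∌X x∈W)) , id ]′ (x∈p∪q⁻ X Y x∈)))
    ... | inj₂ W∌X | inj₂ W∌Y =
      mode-hit (λ x∈⊥ → contradiction x∈⊥ ∉⊥) λ x∈W x∈ → ⊥-elim ([ W∌X x∈W , W∌Y x∈W ]′ (x∈p∪q⁻ X Y x∈))

  -- Correctness of the rounds

  data Chain (β : Tree) : Subset n → ℕ → Set where
    end    : Chain β ⊤ 0
    extend : ∀ {S W q} → Splits I S W → Affordable β W → Chain β (S ∪ W) q → Chain β S (suc q)

  -- While steps are due the chain still has a bag to offer. Once it has ended, `ρ` is empty, layers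
  -- accumulate, and `⊤` survives the surplus rounds.
  rounds-complete : ∀ φ ρ {β S q A} → S ∈ᵗ A → Chain β S q → spine ρ ≤ q → q ≤ spine φ →
                    ⊤ {n} ∈ᵗ rounds I φ ρ β A
  rounds-complete leaf       ρ S∈A end _ _ = S∈A
  rounds-complete (node _ φ) leaf {β} {A = A} S∈A end _ _ =
    rounds-complete φ leaf (step-mono I β A A S∈A) end z≤n z≤n
  rounds-complete (node _ φ) ρ S∈A (extend sp aff chain) ρ≤ q≤ =
    rounds-complete φ (right ρ) (step-hit sp aff S∈A) chain
      (≤-trans (≤-reflexive (spine-right ρ)) (∸-monoˡ-≤ 1 ρ≤)) (≤-pred q≤)

  data Reach : ℕ → Subset n → Set where
    start : Reach 0 ⊥
    next  : ∀ {j L W} → Reach j L → Next I L W → Reach (suc j) (L ∪ W)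

  -- While `ρ` lasts, the old layer is dropped and each new set has made one more step, so
  -- `j + spine ρ` does not fall. Since `ρ` is no longer than `φ`, it is used up at the end and
  -- `r ≤ j` remains.
  rounds-sound : ∀ r φ ρ β A → (∀ S → S ∈ᵗ A → ∃ λ j → Reach j S × r ≤ j + spine ρ) →
                 spine ρ ≤ spine φ → ⊤ {n} ∈ᵗ rounds I φ ρ β A → ∃ λ j → Reach j (⊤ {n}) × r ≤ j
  rounds-sound r leaf leaf β A inv _ ⊤∈ with j , reach , r≤ ← inv (⊤ {n}) ⊤∈ =
    j , reach , subst (r ≤_) (+-identityʳ j) r≤
  rounds-sound r (node _ φ) leaf β A inv _ ⊤∈ =
    rounds-sound r φ leaf β _
      (step-sound I (λ S → ∃ λ j → Reach j S × r ≤ j + 0) A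
        (λ nx L∈A → let j , reach , r≤ = inv _ L∈A in suc j , next reach nx , ≤-trans r≤ (n≤1+n _)) β inv)
      z≤n ⊤∈
  rounds-sound r (node _ φ) (node _ ρ) β A inv ρ≤φ ⊤∈ =
    rounds-sound r φ ρ β _
      (step-sound I (λ S → ∃ λ j → Reach j S × r ≤ j + spine ρ) A
        (λ nx L∈A → let j , reach , r≤ = inv _ L∈A in
          suc j , next reach nx , ≤-trans r≤ (≤-reflexive (+-suc j (spine ρ))))
        β λ S S∈ → contradiction (trans (sym (∈ᵗ⇒member S∈)) (member-leaf S)) λ ())
      (≤-pred ρ≤φ) ⊤∈

  -- From reachability to a path witness

  data Path : ∀ {q} → Subset n → Vec (Subset n) q → Set where
    []  : Path ⊤ []
    _∷_ : ∀ {q L W} {Ws : Vec (Subset n) q} → Next I L W → Path (L ∪ W) Ws → Path L (W ∷ Ws)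

  -- `Reach` exposes the last bag and `Path` the first, so the bags are moved across one by one as
  -- in list reversal.
  reach⇒path : ∀ {j S q} {Ws : Vec (Subset n) q} → Reach j S → Path S Ws →
               ∃₂ λ ℓ (Vs : Vec (Subset n) ℓ) → ℓ ≡ j + q × Path (⊥ {n}) Vs
  reach⇒path start path = _ , _ , refl , path
  reach⇒path {suc j} {q = q} (next reach nx) path with ℓ , Vs , eq , path′ ← reach⇒path reach (nx ∷ path) =
    ℓ , Vs , trans eq (+-suc j q) , path′

  path-covers : ∀ {q S} {Ws : Vec (Subset n) q} → Path S Ws → ∀ v → v ∈ S ⊎ (∃ λ i → v ∈ lookup Ws i)
  path-covers [] v = inj₁ ∈⊤
  path-covers {S = S} {W ∷ Ws} (nx ∷ path) v with path-covers path v
  ... | inj₂ (i , v∈) = inj₂ (suc i , v∈)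
  ... | inj₁ v∈ = map₂ (zero ,_) (x∈p∪q⁻ S W v∈)

  path-fresh : ∀ {q S} {Ws : Vec (Subset n) q} → Path S Ws → ∀ i {v} → v ∈ lookup Ws i → v ∉ S
  path-fresh (nx ∷ path) zero    v∈W v∈S = Next.disjoint nx v∈S v∈W
  path-fresh (nx ∷ path) (suc i) v∈  v∈S = path-fresh path i v∈ (p⊆p∪q _ v∈S)

  path-disjoint : ∀ {q S} {Ws : Vec (Subset n) q} → Path S Ws → ∀ {v} i j →
                  v ∈ lookup Ws i → v ∈ lookup Ws j → i ≡ j
  path-disjoint (nx ∷ path) zero    zero    _   _   = refl
  path-disjoint (nx ∷ path) zero    (suc j) v∈W v∈j = contradiction (q⊆p∪q _ _ v∈W) (path-fresh path j v∈j)
  path-disjoint (nx ∷ path) (suc i) zero    v∈i v∈W = contradiction (q⊆p∪q _ _ v∈W) (path-fresh path i v∈i)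
  path-disjoint (nx ∷ path) (suc i) (suc j) v∈i v∈j = cong suc (path-disjoint path i j v∈i v∈j)

  path-connected : ∀ {q S} {Ws : Vec (Subset n) q} → Path S Ws → ∀ i → InducesConnected (lookup Ws i)
  path-connected (nx ∷ path) zero    = Next.nonempty nx , Next.connected nx
  path-connected (nx ∷ path) (suc i) = path-connected path i

  path-near : ∀ {q S} {Ws : Vec (Subset n) q} → Path S Ws → ∀ j {u v} →
              u ∈ S → v ∈ lookup Ws j → Edge u v → toℕ j ≡ 0
  path-near (nx ∷ path) zero    _   _   _  = refl
  path-near {S = S} (_∷_ {W = W} nx path) (suc j) u∈S v∈j uv =
    contradiction (x∈p∪q⁺ {p = S} {W} (Next.separated nx u∈S uv)) (path-fresh path j v∈j)

  path-edge : ∀ {q S} {Ws : Vec (Subset n) q} → Path S Ws → ∀ i j {u v} → i ≢ j →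
              u ∈ lookup Ws i → v ∈ lookup Ws j → Edge u v → ∣ toℕ i - toℕ j ∣ ≡ 1
  path-edge (nx ∷ path) zero    zero    i≢j _  _  _  = contradiction refl i≢j
  path-edge (nx ∷ path) zero    (suc j) i≢j u∈ v∈ uv = cong suc (path-near path j (q⊆p∪q _ _ u∈) v∈ uv)
  path-edge (nx ∷ path) (suc i) zero    i≢j u∈ v∈ uv =
    cong suc (path-near path i (q⊆p∪q _ _ v∈) u∈ (Edge-sym I uv))
  path-edge (nx ∷ path) (suc i) (suc j) i≢j u∈ v∈ uv = path-edge path i j (i≢j ∘ cong suc) u∈ v∈ uv

  -- As `G` is connected, some edge leaves `S ∪ W`. It cannot start in `S`, whose edges stay within
  -- `S ∪ W`, and it must end in the next bag.
  path-adjacent : ∀ {q S} {Ws : Vec (Subset n) q} → Path S Ws → ∀ i j → toℕ j ≡ suc (toℕ i) →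
                  Adjacent (lookup Ws i) (lookup Ws j)
  path-adjacent {S = S} (_∷_ {W = W} nx (_∷_ {W = W′} nx′ path)) zero (suc zero) eq
    with x , x∈W ← Next.nonempty nx
    with y , y∈W′ ← Next.nonempty nx′
    with a , b , a∈ , b∉ , (_ , _ , ab) ← crossing (S ∪ W) (proj₂ connected {x} {y} ∈⊤ ∈⊤)
           (q⊆p∪q S W x∈W) (λ y∈ → Next.disjoint nx′ y∈ y∈W′)
    = a , b , a∈W , [ (λ b∈ → contradiction b∈ b∉) , id ]′ (Next.separated nx′ a∈ ab) , ab
    where
    a∈W : a ∈ W
    a∈W = [ (λ a∈S → contradiction (x∈p∪q⁺ {p = S} {W} (Next.separated nx a∈S ab)) b∉) , id ]′ (x∈p∪q⁻ S W a∈)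
  path-adjacent (nx ∷ path) (suc i) (suc j) eq = path-adjacent path i j (suc-injective eq)

  Adjacent-sym : ∀ {S T} → Adjacent S T → Adjacent T S
  Adjacent-sym (u , v , u∈ , v∈ , uv) = v , u , v∈ , u∈ , Edge-sym I uv

  -- The last step keeps `Y` out of the union of all bags before it, and nothing comes after it.
  path-Y : ∀ {m S} {Ws : Vec (Subset n) (suc m)} → Path S Ws → Y ⊆ lookup Ws (fromℕ m)
  path-Y {zero} {S} (_∷_ {W = W} nx path) v∈Y =
    [ (λ v∈S → contradiction v∈S (Next.Y∩ nx v∈Y)) , id ]′ (x∈p∪q⁻ S W (all path))
    where
    all : ∀ {V} {Ws : Vec (Subset n) 0} {v} → Path V Ws → v ∈ V
    all [] = ∈⊤
  path-Y {suc m} (nx ∷ path) v∈Y = path-Y path v∈Y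

  -- Translates a lower bound on the number of bags, which the rounds guarantee, into an upper bound
  -- on the contractions.
  path-size : ∀ {q S} {Ws : Vec (Subset n) q} → Path S Ws → ∣ S ∣ + (contractions Ws + q) ≡ n
  path-size [] = trans (+-identityʳ _) (∣⊤∣≡n n)
  path-size {suc q} {S} (_∷_ {W = W} {Ws} nx path) = begin
    ∣ S ∣ + (∣ W ∣ ∸ 1 + contractions Ws + suc q)     ≡⟨ cong (∣ S ∣ +_) (+-suc (∣ W ∣ ∸ 1 + contractions Ws) q) ⟩
    ∣ S ∣ + (1 + (∣ W ∣ ∸ 1 + contractions Ws) + q)
      ≡⟨ cong (λ z → ∣ S ∣ + (z + contractions Ws + q)) (m+[n∸m]≡n ∣W∣>0) ⟩
    ∣ S ∣ + (∣ W ∣ + contractions Ws + q)             ≡⟨ cong (∣ S ∣ +_) (+-assoc ∣ W ∣ (contractions Ws) q) ⟩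
    ∣ S ∣ + (∣ W ∣ + (contractions Ws + q))           ≡⟨ +-assoc ∣ S ∣ ∣ W ∣ _ ⟨
    ∣ S ∣ + ∣ W ∣ + (contractions Ws + q)
      ≡⟨ cong (_+ (contractions Ws + q)) (∣p∪q∣≡∣p∣+∣q∣ S W (Next.disjoint nx)) ⟨
    ∣ S ∪ W ∣ + (contractions Ws + q)                 ≡⟨ path-size path ⟩
    n                                                 ∎
    where
    open ≡-Reasoning
    ∣W∣>0 : 1 ≤ ∣ W ∣
    ∣W∣>0 = let x , x∈W = Next.nonempty nx in
      ≤-trans (≤-reflexive (sym (∣⁅x⁆∣≡1 x)))
        (p⊆q⇒∣p∣≤∣q∣ λ y∈ → subst (_∈ W) (sym (x∈⁅y⁆⇒x≡y x y∈)) x∈W)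

  path⇒witness : ∀ {m} {Ws : Vec (Subset n) (suc m)} → Path (⊥ {n}) Ws → IsPathWitness G Ws
  path⇒witness {Ws = Ws} path = record
    { covering  = λ v → [ (λ v∈⊥ → contradiction v∈⊥ ∉⊥) , id ]′ (path-covers path v)
    ; disjoint  = λ {v} {i} {j} → path-disjoint path i j
    ; nonempty  = λ i → proj₁ (path-connected path i)
    ; connected = path-connected path
    ; path      = λ i j i≢j → mk⇔
        (λ (u , v , u∈ , v∈ , uv) → path-edge path i j i≢j u∈ v∈ uv)
        λ eq → [ path-adjacent path i j , Adjacent-sym ∘ path-adjacent path j i ]′ (∣m-n∣≡1 (toℕ i) (toℕ j) eq)
    }

  spine-remaining : spine (remaining I) ≡ n ∸ k′ I
  spine-remaining = trans (spine-discount (⊤ {k′ I}) ⌜ X ⌝ˢ) (cong₂ _∸_ (spine-⌜⌝ X) (∣⊤∣≡n (k′ I)))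

  start-only : ∀ S → S ∈ᵗ insert (⊥ {n}) leaf → ∃ λ j → Reach j S × n ∸ k′ I ≤ j + spine (remaining I)
  start-only S (stored S∈) with member-insert⁻ S ⊥ leaf S∈
  ... | inj₁ refl = 0 , start , ≤-reflexive (sym spine-remaining)
  ... | inj₂ S∈leaf = contradiction (trans (sym S∈leaf) (member-leaf S)) λ ()

  answer-sound : answer I ≡ true → PathContractionWithConstrainedEnds I
  answer-sound eq
    with j , reach , r≤j ← rounds-sound (n ∸ k′ I) ⌜ X ⌝ˢ (remaining I) (budget I) _ start-only
           (≤-trans (≤-reflexive spine-remaining) (≤-trans (m∸n≤m n (k′ I)) (≤-reflexive (sym (spine-⌜⌝ X)))))
           (stored eq)
    with reach⇒path reach []
  -- Without bags `⊥` would be `⊤`, but a connected graph has a vertex.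
  ... | zero , [] , _ , path = contradiction
            ([ id , (λ ()) ]′ (path-covers path (proj₁ (proj₁ connected)))) ∉⊥
  ... | suc m , Ws , eq , path@(nx ∷ _) = m , Ws , path⇒witness path , contractions≤k , X⊆ , path-Y path
    where
    X⊆ : X ⊆ lookup Ws zero
    X⊆ x∈X = [ (λ x∈⊥ → contradiction x∈⊥ ∉⊥) , id ]′ (x∈p∪q⁻ ⊥ _ (Next.X⊆ nx x∈X))
    contractions≤k : contractions Ws ≤ k
    contractions≤k = ≤-trans (+-cancelʳ-≤ (suc m) _ _ (begin
      contractions Ws + suc m                      ≡⟨ cong (_+ (contractions Ws + suc m)) (∣⊥∣≡0 n) ⟨
      ∣ ⊥ {n} ∣ + (contractions Ws + suc m)        ≡⟨ path-size path ⟩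
      n                                            ≤⟨ ≤-trans (m≤n+m∸n n (k′ I)) (+-monoʳ-≤ (k′ I) r≤j) ⟩
      k′ I + j                                     ≡⟨ cong (k′ I +_) (trans eq (+-identityʳ j)) ⟨
      k′ I + suc m                                 ∎)) (k′≤k I)
      where open ≤-Reasoning

-- From a path witness to a run of the algorithm

unionOver : ∀ {n ℓ} → Subset ℓ → Vec (Subset n) ℓ → Subset n
unionOver []      []       = ⊥
unionOver (b ∷ Q) (W ∷ Ws) = if b then W ∪ unionOver Q Ws else unionOver Q Ws

∈-unionOver : ∀ {n ℓ} {Q : Subset ℓ} (Ws : Vec (Subset n) ℓ) {i v} → i ∈ Q → v ∈ lookup Ws i → v ∈ unionOver Q Ws
∈-unionOver (W ∷ Ws) here v∈ = p⊆p∪q _ v∈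
∈-unionOver {Q = false ∷ Q} (W ∷ Ws) (there i∈Q) v∈ = ∈-unionOver Ws i∈Q v∈
∈-unionOver {Q = true ∷ Q}  (W ∷ Ws) (there i∈Q) v∈ = q⊆p∪q W _ (∈-unionOver Ws i∈Q v∈)

-- A bag has at most one vertex more than its own contractions. Used with five bags for the budget
-- and with all bags for the number of rounds.
∣unionOver∣≤ : ∀ {n ℓ} (Q : Subset ℓ) (Ws : Vec (Subset n) ℓ) → ∣ unionOver Q Ws ∣ ≤ contractions Ws + ∣ Q ∣
∣unionOver∣≤ {n} [] [] = ≤-reflexive (∣⊥∣≡0 n)
∣unionOver∣≤ (false ∷ Q) (W ∷ Ws) =
  ≤-trans (∣unionOver∣≤ Q Ws) (+-monoˡ-≤ ∣ Q ∣ (m≤n+m (contractions Ws) (∣ W ∣ ∸ 1)))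
∣unionOver∣≤ (true ∷ Q) (W ∷ Ws) = begin
  ∣ W ∪ unionOver Q Ws ∣                        ≤⟨ ∣p∪q∣≤∣p∣+∣q∣ W (unionOver Q Ws) ⟩
  ∣ W ∣ + ∣ unionOver Q Ws ∣                    ≤⟨ +-mono-≤ (m≤n+m∸n ∣ W ∣ 1) (∣unionOver∣≤ Q Ws) ⟩
  1 + (∣ W ∣ ∸ 1) + (contractions Ws + ∣ Q ∣)   ≡⟨ rearrange (∣ W ∣ ∸ 1) (contractions Ws) ∣ Q ∣ ⟩
  ∣ W ∣ ∸ 1 + contractions Ws + suc ∣ Q ∣       ∎
  where
  open ≤-Reasoning
  rearrange : ∀ x y z → 1 + x + (y + z) ≡ x + y + (1 + z)
  rearrange = solve-∀

∈-tabulate⁺ : ∀ {n} (f : Fin n → Bool) {v} → f v ≡ true → v ∈ tabulate f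
∈-tabulate⁺ f {v} eq = lookup⇒[]= v _ (trans (lookup∘tabulate f v) eq)

∈-tabulate⁻ : ∀ {n} (f : Fin n → Bool) {v} → v ∈ tabulate f → f v ≡ true
∈-tabulate⁻ f {v} v∈ = trans (sym (lookup∘tabulate f v)) ([]=⇒lookup v∈)

T⇒≡ : ∀ {b} → T b → b ≡ true
T⇒≡ {true} _ = refl

module _ (I : Instance) where

  open Instance I renaming (connected to G-connected; disjoint to X-Y-disjoint)
  open Graph G

  -- The empty alternative handles the first bag of the inductions along the path from either end.
  Conn-∪ : ∀ {S U} → Conn I S → Conn I U → Empty S ⊎ Adjacent S U → Conn I (S ∪ U)
  Conn-∪ {S} {U} cS cU (inj₁ empty) = subst (Conn I) (sym S∪U≡U) cU
    where
    S∪U≡U : S ∪ U ≡ U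
    S∪U≡U = trans (cong (_∪ U) (Empty-unique empty)) (∪-identityˡ U)
  Conn-∪ {S} {U} cS cU (inj₂ (a , b , a∈S , b∈U , ab)) x∈ y∈ = toA x∈ ◅◅ reverse I (toA y∈)
    where
    lift₁ : ∀ {x y} → Star (EdgeWithin S) x y → Star (EdgeWithin (S ∪ U)) x y
    lift₁ = Star.map λ (x∈ , y∈ , xy) → p⊆p∪q U x∈ , p⊆p∪q U y∈ , xy
    lift₂ : ∀ {x y} → Star (EdgeWithin U) x y → Star (EdgeWithin (S ∪ U)) x y
    lift₂ = Star.map λ (x∈ , y∈ , xy) → q⊆p∪q S U x∈ , q⊆p∪q S U y∈ , xy
    toA : ∀ {x} → x ∈ S ∪ U → Star (EdgeWithin (S ∪ U)) x a
    toA x∈ with x∈p∪q⁻ S U x∈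
    ... | inj₁ x∈S = lift₁ (cS x∈S a∈S)
    ... | inj₂ x∈U = lift₂ (cU x∈U b∈U) ◅◅ ((q⊆p∪q S U b∈U , p⊆p∪q U a∈S , Edge-sym I ab) ◅ ε)

  module _ {m : ℕ} {W : Vec (Subset n) (suc m)} (witness : IsPathWitness G W)
    (≤k : contractions W ≤ k) (X⊆ : X ⊆ lookup W zero) (Y⊆ : Y ⊆ lookup W (fromℕ m)) where

    open IsPathWitness witness

    index : Fin n → Fin (suc m)
    index v = proj₁ (covering v)

    ∈index : ∀ v → v ∈ lookup W (index v)
    ∈index v = proj₂ (covering v)

    index-unique : ∀ {v i} → v ∈ lookup W i → index v ≡ i
    index-unique v∈ = disjoint (∈index _) v∈

    pos : Fin n → ℕ
    pos v = toℕ (index v)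

    pos-X : ∀ {v} → v ∈ X → pos v ≡ 0
    pos-X v∈X = cong toℕ (index-unique (X⊆ v∈X))

    pos-Y : ∀ {v} → v ∈ Y → pos v ≡ m
    pos-Y v∈Y = trans (cong toℕ (index-unique (Y⊆ v∈Y))) (toℕ-fromℕ m)

    pos≤m : ∀ v → pos v ≤ m
    pos≤m v = ≤-pred (toℕ<n (index v))

    edge-pos : ∀ {u v} → Edge u v → pos u ≡ pos v ⊎ pos v ≡ suc (pos u) ⊎ pos u ≡ suc (pos v)
    edge-pos {u} {v} uv with index u ≟ᶠ index v
    ... | yes eq = inj₁ (cong toℕ eq)
    ... | no  ne = inj₂ (∣m-n∣≡1 _ _ (Equivalence.to (path _ _ ne) (u , v , ∈index u , ∈index v , uv)))

    before : ℕ → Subset n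
    before i = tabulate λ v → pos v <ᵇ i

    before⁺ : ∀ {i v} → pos v < i → v ∈ before i
    before⁺ {i} lt = ∈-tabulate⁺ (λ v → pos v <ᵇ i) (T⇒≡ (<⇒<ᵇ lt))

    before⁻ : ∀ {i v} → v ∈ before i → pos v < i
    before⁻ {i} {v} v∈ = <ᵇ⇒< (pos v) i (subst T (sym (∈-tabulate⁻ (λ v → pos v <ᵇ i) v∈)) _)

    bag : ∀ {i} → i < suc m → Subset n
    bag i<ℓ = lookup W (fromℕ< i<ℓ)

    bag⁺ : ∀ {i v} (i<ℓ : i < suc m) → pos v ≡ i → v ∈ bag i<ℓ
    bag⁺ {i} {v} i<ℓ eq = subst (λ j → v ∈ lookup W j) (toℕ-injective (trans eq (sym (toℕ-fromℕ< i<ℓ)))) (∈index v)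

    bag⁻ : ∀ {i v} (i<ℓ : i < suc m) → v ∈ bag i<ℓ → pos v ≡ i
    bag⁻ i<ℓ v∈ = trans (cong toℕ (index-unique v∈)) (toℕ-fromℕ< i<ℓ)

    before-zero : before 0 ≡ ⊥
    before-zero = Empty-unique λ (v , v∈) → contradiction (before⁻ {0} v∈) λ ()

    before-all : before (suc m) ≡ ⊤
    before-all = ⊆-antisym (⊆-max _) λ {v} _ → before⁺ (s≤s (pos≤m v))

    before-suc : ∀ {i} (i<ℓ : i < suc m) → before i ∪ bag i<ℓ ≡ before (suc i)
    before-suc {i} i<ℓ = ⊆-antisym
      (λ v∈ → before⁺ ([ (λ v∈ → m≤n⇒m≤1+n (before⁻ v∈)) , (λ v∈ → s≤s (≤-reflexive (bag⁻ i<ℓ v∈))) ]′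
        (x∈p∪q⁻ _ _ v∈)))
      (λ v∈ → x∈p∪q⁺ ([ inj₁ ∘ before⁺ , inj₂ ∘ bag⁺ i<ℓ ]′ (m≤n⇒m<n∨m≡n (≤-pred (before⁻ v∈)))))

    consecutive : ∀ {i} (i<ℓ : i < suc m) (1+i<ℓ : suc i < suc m) → Adjacent (bag i<ℓ) (bag 1+i<ℓ)
    consecutive {i} i<ℓ 1+i<ℓ = Equivalence.from
      (path _ _ λ eq →
        1+n≢n (sym (trans (sym (toℕ-fromℕ< i<ℓ)) (trans (cong toℕ eq) (toℕ-fromℕ< 1+i<ℓ)))))
      (trans (cong₂ ∣_-_∣ (toℕ-fromℕ< i<ℓ) (toℕ-fromℕ< 1+i<ℓ)) (lemma i))
      where
      lemma : ∀ i → ∣ i - suc i ∣ ≡ 1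
      lemma zero    = refl
      lemma (suc i) = lemma i

    before-connected : ∀ {i} → i ≤ suc m → Conn I (before i)
    before-connected {zero} _ = subst (Conn I) (sym before-zero) (Conn-⊥ I)
    before-connected {suc zero} i<ℓ = subst (Conn I) (before-suc i<ℓ)
      (Conn-∪ (before-connected z≤n) (proj₂ (connected _)) (inj₁ λ (v , v∈) → contradiction (before⁻ {0} v∈) λ ()))
    before-connected {suc (suc i)} i<ℓ = subst (Conn I) (before-suc i<ℓ)
      (Conn-∪ (before-connected i<ℓ′) (proj₂ (connected _)) (inj₂ joined))
      where
      i<ℓ′ : i < suc m
      i<ℓ′ = <⇒≤ i<ℓ
      joined : Adjacent (before (suc i)) (bag i<ℓ)
      joined = let a , b , a∈ , b∈ , ab = consecutive i<ℓ′ i<ℓ in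
            a , b , before⁺ (s≤s (≤-reflexive (bag⁻ i<ℓ′ a∈))) , b∈ , ab

    after-all : ∁ (before (suc m)) ≡ ⊥
    after-all = Empty-unique λ (v , v∈) → x∈∁p⇒x∉p v∈ (before⁺ (s≤s (pos≤m v)))

    after⁺ : ∀ {i v} → i ≤ pos v → v ∈ ∁ (before i)
    after⁺ i≤ = x∉p⇒x∈∁p λ v∈ → <⇒≱ (before⁻ v∈) i≤

    after⁻ : ∀ {i v} → v ∈ ∁ (before i) → i ≤ pos v
    after⁻ v∈ = ≮⇒≥ λ lt → x∈∁p⇒x∉p v∈ (before⁺ lt)

    after-suc : ∀ {i} (i<ℓ : i < suc m) → ∁ (before (suc i)) ∪ bag i<ℓ ≡ ∁ (before i)
    after-suc {i} i<ℓ = ⊆-antisym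
      (λ v∈ → after⁺ ([ (λ v∈ → ≤-trans (n≤1+n _) (after⁻ v∈)) , (λ v∈ → ≤-reflexive (sym (bag⁻ i<ℓ v∈))) ]′
        (x∈p∪q⁻ _ _ v∈)))
      (λ v∈ → x∈p∪q⁺ ([ inj₁ ∘ after⁺ , inj₂ ∘ bag⁺ i<ℓ ∘ sym ]′ (m≤n⇒m<n∨m≡n (after⁻ v∈))))

    after-connected : ∀ q {i} → i + q ≡ suc m → Conn I (∁ (before i))
    after-connected zero {i} eq = subst (Conn I)
      (sym (trans (cong (∁ ∘ before) (trans (sym (+-identityʳ i)) eq)) after-all)) (Conn-⊥ I)
    after-connected (suc q) {i} eq = subst (Conn I) (after-suc i<ℓ)
      (Conn-∪ (after-connected q (trans (sym (+-suc i q)) eq)) (proj₂ (connected _)) (join q eq))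
      where
      i<ℓ : i < suc m
      i<ℓ = m+n≤o⇒m≤o (suc i) (≤-reflexive (trans (sym (+-suc i q)) eq))
      join : ∀ q → i + suc q ≡ suc m → Empty (∁ (before (suc i))) ⊎ Adjacent (∁ (before (suc i))) (bag i<ℓ)
      join zero eq = inj₁ λ (v , v∈) →
        <⇒≱ (s≤s (pos≤m v)) (subst (_≤ pos v) (trans (sym (+-comm i 1)) eq) (after⁻ v∈))
      join (suc q) eq =
        let a , b , a∈ , b∈ , ab = consecutive i<ℓ 1+i<ℓ in
        inj₂ (b , a , after⁺ (≤-reflexive (sym (bag⁻ 1+i<ℓ b∈))) , a∈ , Edge-sym I ab)
        where
        1+i<ℓ : suc i < suc m
        1+i<ℓ = m+n≤o⇒m≤o (2 + i) (≤-reflexive (trans (sym (trans (+-suc i (suc q)) (cong suc (+-suc i q)))) eq))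

    splits : ∀ {i q} (i<ℓ : i < suc m) → suc i + q ≡ suc m → Splits I (before i) (bag i<ℓ)
    splits {i} {q} i<ℓ eq = record
      { next = record
        { nonempty  = nonempty _
        ; connected = proj₂ (connected _)
        ; disjoint  = λ v∈L v∈W → <⇒≢ (before⁻ v∈L) (bag⁻ i<ℓ v∈W)
        ; separated = separated
        ; X⊆        = λ v∈X → subst (_ ∈_) (sym (before-suc i<ℓ))
                        (before⁺ (s≤s (≤-trans (≤-reflexive (pos-X v∈X)) z≤n)))
        ; Y∩        = λ v∈Y v∈L → <⇒≱ (before⁻ v∈L) (≤-trans (≤-pred i<ℓ) (≤-reflexive (sym (pos-Y v∈Y))))
        }
      ; left-connected  = before-connected (<⇒≤ i<ℓ)
      ; right-connected = subst (Conn I) (cong ∁ (sym (before-suc i<ℓ))) (after-connected q eq)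
      }
      where
      separated : ∀ {u v} → u ∈ before i → Edge u v → v ∈ before i ⊎ v ∈ bag i<ℓ
      separated {u} {v} u∈ uv = x∈p∪q⁻ _ _
        (subst (v ∈_) (sym (before-suc i<ℓ)) (before⁺ (s≤s (≤-trans v≤ (before⁻ u∈)))))
        where
        v≤ : pos v ≤ suc (pos u)
        v≤ with edge-pos uv
        ... | inj₁ eq        = ≤-trans (≤-reflexive (sym eq)) (n≤1+n _)
        ... | inj₂ (inj₁ eq) = ≤-reflexive eq
        ... | inj₂ (inj₂ eq) = ≤-trans (n≤1+n _) (≤-trans (≤-reflexive (sym eq)) (n≤1+n _))

    -- The bags i − 1, i, i + 1 and both ends cover everything that is branched on.
    affordable : ∀ {i} (i<ℓ : i < suc m) → Affordable I (budget I) (bag i<ℓ)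
    affordable {i} i<ℓ = record
      { costly   = Z ─ (X ∪ Y)
      ; size     = size
      ; costly⁺  = λ u∉ near → x∈p∧x∉q⇒x∈p─q (near⊆Z near) u∉
      ; X-uncut  = X-uncut
      ; Y-uncut  = Y-uncut
      }
      where
      -- At an end of the path bag `i + 1` or `i − 1` is missing; then `zero` stands in, and the
      -- claim about it is vacuous. Taking `suc ∘ toℕ` for the predecessor avoids truncated
      -- subtraction.
      neighbour : (f : Fin (suc m) → ℕ) (c : ℕ) →
                  ∃ λ s → ∀ j → f j ≡ c → (∀ {x y} → f x ≡ c → f y ≡ c → x ≡ y) → j ≡ s
      neighbour f c with any? (λ s → f s ≟ c)
      ... | yes (s , eq) = s , λ j eq′ inj → inj eq′ eq
      ... | no  ¬s       = zero , λ j eq′ _ → contradiction (j , eq′) ¬s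
      succ = neighbour toℕ (suc i)
      pred′ = neighbour (suc ∘ toℕ) i
      rest : Subset (suc m)
      rest = ⁅ fromℕ< i<ℓ ⁆ ∪ ⁅ proj₁ succ ⁆ ∪ ⁅ proj₁ pred′ ⁆
      Q : Subset (suc m)
      Q = ⁅ zero ⁆ ∪ ⁅ fromℕ m ⁆ ∪ rest
      ∣Q∣≤5 : ∣ Q ∣ ≤ 5
      ∣Q∣≤5 = add zero (⁅ fromℕ m ⁆ ∪ rest) (add (fromℕ m) rest
        (add (fromℕ< i<ℓ) (⁅ proj₁ succ ⁆ ∪ ⁅ proj₁ pred′ ⁆)
          (add (proj₁ succ) ⁅ proj₁ pred′ ⁆ (≤-reflexive (∣⁅x⁆∣≡1 (proj₁ pred′))))))
        where
        add : ∀ x (R : Subset (suc m)) {c} → ∣ R ∣ ≤ c → ∣ ⁅ x ⁆ ∪ R ∣ ≤ suc c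
        add x R ≤c = ≤-trans (∣p∪q∣≤∣p∣+∣q∣ ⁅ x ⁆ R) (+-mono-≤ (≤-reflexive (∣⁅x⁆∣≡1 x)) ≤c)
      Z : Subset n
      Z = unionOver Q W
      Z⁺ : ∀ {v j} → index v ≡ j → j ∈ Q → v ∈ Z
      Z⁺ {v} refl j∈Q = ∈-unionOver W j∈Q (∈index v)
      zero∈Q : zero ∈ Q
      zero∈Q = p⊆p∪q _ (x∈⁅x⁆ _)
      last∈Q : fromℕ m ∈ Q
      last∈Q = q⊆p∪q ⁅ zero ⁆ _ (p⊆p∪q _ (x∈⁅x⁆ _))
      rest⊆Q : rest ⊆ Q
      rest⊆Q = q⊆p∪q ⁅ zero ⁆ _ ∘ q⊆p∪q ⁅ fromℕ m ⁆ _
      i∈Q : fromℕ< i<ℓ ∈ Q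
      i∈Q = rest⊆Q (p⊆p∪q _ (x∈⁅x⁆ _))
      succ∈Q : proj₁ succ ∈ Q
      succ∈Q = rest⊆Q (q⊆p∪q ⁅ fromℕ< i<ℓ ⁆ _ (p⊆p∪q _ (x∈⁅x⁆ _)))
      pred∈Q : proj₁ pred′ ∈ Q
      pred∈Q = rest⊆Q (q⊆p∪q ⁅ fromℕ< i<ℓ ⁆ _ (q⊆p∪q ⁅ proj₁ succ ⁆ _ (x∈⁅x⁆ _)))
      near⊆Z : ∀ {u} → u ∈ bag i<ℓ ⊎ (∃ λ w → w ∈ bag i<ℓ × Edge w u) → u ∈ Z
      near⊆Z (inj₁ u∈) = Z⁺ (index-unique u∈) i∈Q
      near⊆Z {u} (inj₂ (w , w∈ , wu)) with edge-pos wu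
      ... | inj₁ eq = Z⁺ (toℕ-injective (trans (sym eq) (trans (bag⁻ i<ℓ w∈) (sym (toℕ-fromℕ< i<ℓ))))) i∈Q
      ... | inj₂ (inj₁ eq) = Z⁺ (proj₂ succ (index u) (trans eq (cong suc (bag⁻ i<ℓ w∈)))
                                  (λ e e′ → toℕ-injective (trans e (sym e′)))) succ∈Q
      ... | inj₂ (inj₂ eq) = Z⁺ (proj₂ pred′ (index u) (trans (sym eq) (bag⁻ i<ℓ w∈))
                                  (λ e e′ → toℕ-injective (suc-injective (trans e (sym e′))))) pred∈Q
      -- The reason for including the end bags: the sizes of `X` and `Y` can then be subtracted from
      -- that of `Z`.
      X∪Y⊆Z : X ∪ Y ⊆ Z
      X∪Y⊆Z v∈ =
        [ (λ v∈X → Z⁺ (index-unique (X⊆ v∈X)) zero∈Q) , (λ v∈Y → Z⁺ (index-unique (Y⊆ v∈Y)) last∈Q) ]′ (x∈p∪q⁻ X Y v∈)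
      D : Subset n
      D = Z ─ (X ∪ Y)
      split : ∣ D ∣ + (∣ X ∣ + ∣ Y ∣) ≤ ∣ Z ∣
      split = begin
        ∣ D ∣ + (∣ X ∣ + ∣ Y ∣)
          ≡⟨ cong (∣ D ∣ +_) (∣p∪q∣≡∣p∣+∣q∣ X Y (λ v∈X v∈Y → X-Y-disjoint (_ , x∈p∩q⁺ (v∈X , v∈Y)))) ⟨
        ∣ D ∣ + ∣ X ∪ Y ∣        ≡⟨ ∣p∪q∣≡∣p∣+∣q∣ D (X ∪ Y) (x∈p─q⇒x∉q Z (X ∪ Y)) ⟨
        ∣ D ∪ (X ∪ Y) ∣          ≤⟨ p⊆q⇒∣p∣≤∣q∣ (λ v∈ → [ p─q⊆p Z (X ∪ Y) , X∪Y⊆Z ]′ (x∈p∪q⁻ D (X ∪ Y) v∈)) ⟩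
        ∣ Z ∣                    ∎
        where open ≤-Reasoning
      ∣Z∣≤ : ∣ Z ∣ ≤ 5 + k′ I
      ∣Z∣≤ = begin
        -- The budget is made from the capped `k′`, known only to be at least `n ⊓ k`, so `Z` is
        -- compared with `n` as well.
        ∣ Z ∣              ≤⟨ ⊓-glb (≤-trans (∣p∣≤n Z) (m≤n+m n 5)) Z≤5+k ⟩
        (5 + n) ⊓ (5 + k)  ≡⟨⟩
        5 + n ⊓ k          ≤⟨ +-monoʳ-≤ 5 (n⊓k≤k′ I) ⟩
        5 + k′ I           ∎
        where
        open ≤-Reasoning
        Z≤5+k : ∣ Z ∣ ≤ 5 + k
        Z≤5+k = ≤-trans (∣unionOver∣≤ Q W) (≤-trans (+-mono-≤ ≤k ∣Q∣≤5) (≤-reflexive (+-comm k 5)))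
      size : ∣ D ∣ ≤ spine (budget I)
      size = ≤-trans (m+n≤o⇒m≤o∸n ∣ D ∣ (≤-trans split ∣Z∣≤)) (≤-reflexive (sym (spine-budget I)))
      X-uncut : X ⊆ bag i<ℓ ⊎ (∀ {x} → x ∈ bag i<ℓ → x ∉ X)
      X-uncut with i ≟ 0
      ... | yes refl = inj₁ λ x∈X → bag⁺ i<ℓ (pos-X x∈X)
      ... | no  i≢0  = inj₂ λ x∈ x∈X → i≢0 (trans (sym (bag⁻ i<ℓ x∈)) (pos-X x∈X))
      Y-uncut : Y ⊆ bag i<ℓ ⊎ (∀ {x} → x ∈ bag i<ℓ → x ∉ Y)
      Y-uncut with i ≟ m
      ... | yes refl = inj₁ λ x∈Y → bag⁺ i<ℓ (pos-Y x∈Y)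
      ... | no  i≢m  = inj₂ λ x∈ x∈Y → i≢m (trans (sym (bag⁻ i<ℓ x∈)) (pos-Y x∈Y))

    chain : ∀ q {i} → i + q ≡ suc m → Chain I (budget I) (before i) q
    chain zero {i} eq = subst (λ S → Chain I (budget I) S 0)
      (sym (trans (cong before (trans (sym (+-identityʳ i)) eq)) before-all)) end
    chain (suc q) {i} eq = extend (splits i<ℓ eq′) (affordable i<ℓ)
      (subst (λ S → Chain I (budget I) S q) (sym (before-suc i<ℓ)) (chain q eq′))
      where
      eq′ : suc i + q ≡ suc m
      eq′ = trans (sym (+-suc i q)) eq
      i<ℓ : i < suc m
      i<ℓ = m+n≤o⇒m≤o (suc i) (≤-reflexive eq′)

    -- One vertex from each bag; this makes the fuel of length `n` sufficient for `rounds`.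
    length≤n : suc m ≤ n
    length≤n = injective⇒≤ {f = λ i → proj₁ (nonempty i)} λ {i} {j} eq →
      disjoint (proj₂ (nonempty i)) (subst (_∈ lookup W j) (sym eq) (proj₂ (nonempty j)))

    n∸k′≤length : n ∸ k′ I ≤ suc m
    n∸k′≤length = m≤n+o⇒m∸n≤o n (k′ I) (begin
      n                            ≤⟨ ⊓-glb (m≤m+n n (suc m)) n≤k+1+m ⟩
      (n + suc m) ⊓ (k + suc m)    ≡⟨ +-distribʳ-⊓ (suc m) n k ⟨
      n ⊓ k + suc m                ≤⟨ +-monoˡ-≤ (suc m) (n⊓k≤k′ I) ⟩
      k′ I + suc m                 ∎)
      where
      open ≤-Reasoning
      n≤k+1+m : n ≤ k + suc m
      n≤k+1+m = begin
        n                                ≡⟨ ∣⊤∣≡n n ⟨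
        ∣ ⊤ {n} ∣
          ≤⟨ p⊆q⇒∣p∣≤∣q∣ {p = ⊤ {n}} (λ {v} _ → ∈-unionOver W (∈⊤ {x = index v}) (∈index v)) ⟩
        ∣ unionOver ⊤ W ∣                ≤⟨ ∣unionOver∣≤ ⊤ W ⟩
        contractions W + ∣ ⊤ {suc m} ∣   ≤⟨ +-mono-≤ ≤k (≤-reflexive (∣⊤∣≡n (suc m))) ⟩
        k + suc m                        ∎

    answer-complete′ : answer I ≡ true
    answer-complete′ = ∈ᵗ⇒member (rounds-complete I ⌜ X ⌝ˢ (remaining I)
      {S = before 0} (subst (_∈ᵗ insert (⊥ {n}) leaf) (sym before-zero) (stored (member-insert (⊥ {n}) leaf)))
      (chain (suc m) {0} refl)
      (≤-trans (≤-reflexive (spine-remaining I)) n∸k′≤length)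
      (≤-trans length≤n (≤-reflexive (sym (spine-⌜⌝ X)))))

  answer-complete : PathContractionWithConstrainedEnds I → answer I ≡ true
  answer-complete (m , W , witness , ≤k , X⊆ , Y⊆) = answer-complete′ witness ≤k X⊆ Y⊆

-- Assembling the decision procedure and its running time

program : Program
program = record { bodies = bs ; main = main-body }

answers : ∀ I → Answers (PathContractionWithConstrainedEnds I) ⌜ answer I ⌝ᵇ
answers I = decide (answer I) (answer-sound I) (answer-complete I)
  where
  decide : ∀ {A} b → (b ≡ true → A) → (A → b ≡ true) → Answers A ⌜ b ⌝ᵇ
  decide true  sound complete = Answers.yes (sound refl)
  decide false sound complete = Answers.no λ a → contradiction (complete a) λ ()

-- Abstract because the coefficients of O-time are astronomically large numerals.
abstract
  time : Instance → ℕ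
  time I = cost (κ I p) main-body

  runs : ∀ I → ∃ λ t → Run program (encode I) ⌜ answer I ⌝ᵇ t × t ≤ time I
  runs I = evaluates I (main⇓ I)

  O-time : O 1 time
  O-time = O-main

theorem1 : ∃[ P ] ∃[ c ] ∃[ d ]
    DecidesInTime P PathContractionWithConstrainedEnds
    (λ I → c * inputSize I ^ d * 2 ^ exponent I)
theorem1 = program , O.coefficient O-time , O.degree O-time , λ I →
  let t , run , t≤ = runs I in
  ⌜ answer I ⌝ᵇ , t , run , answers I ,
  ≤-trans t≤ (≤-trans (O.bound O-time I)
    (≤-reflexive (cong (O.coefficient O-time * inputSize I ^ O.degree O-time *_) (*-identityʳ (2 ^ exponent I)))))
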